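{- Let $n\ge1$ and let $\overrightarrow{B_n}$ be the directed bouquet of $n$ loops, modelled as the simple graph with central vertex $c$ and, for each loop $i=1,\dots,n$, a black vertex $b_i$ and a white vertex $w_i$ with edges $cb_i$, $b_iw_i$, $w_ic$ (the loop is oriented from $b_i$ to $w_i$). Its automorphism group is $S_n$, where $\sigma\in S_n$ fixes $c$ and sends $b_i\mapsto b_{\sigma(i)}$, $w_i\mapsto w_{\sigma(i)}$; cycle types are recorded on the $n$ directed loops. For a divisor $d$ of $n$, the number $i_d$ of unlabeled imbeddings of $\overrightarrow{B_n}$ that are $d$-fold symmetric, i.e. whose map-automorphism group is cyclic of order $d$ generated by a permutation of the $n$ loops with all cycles of length $d$ (the group $C_d[E_{n/d}]$), is \[ i_d=\frac{d}{2n}\sum_{k:\ d\mid k,\ k\mid n}\mu(k/d)\,\frac{(2n/k)!\,k^{n/k}}{(n/k)!},\] where $\mu$ is the Möbius function.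
   Context: A rotation at a vertex $v$ is a cyclic permutation of its neighborhood $N(v)$ (a single cycle through all of $N(v)$); a map is the graph together with a rotation system $\rho=\{\rho_v\}$ (so only the rotation at $c$, a cyclic ordering of the $2n$ vertices $b_i,w_i$, is a genuine choice). The group $S_n$ acts on maps by $\rho\mapsto\rho'$ with $\rho'_{\sigma(v)}=\sigma\rho_v\sigma^{ -1}$; the stabilizer of a map $M$ is its map-automorphism group, and the $S_n$-orbits of maps are the unlabeled imbeddings. -}

module Defs where

open import Data.Nat using (ℕ; zero; suc; _+_; _*_; _<_; _^_; _!)
open import Data.Nat.DivMod using (_/_)
open import Data.Nat.Divisibility using (_∣_; _∣?_)
open import Data.Nat.Primality using (prime?)
open import Data.Integer as ℤ using (ℤ; +_; -_)
open import Data.Fin using (Fin)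
open import Data.Fin.Permutation using (Permutation′; _⟨$⟩ʳ_; _⟨$⟩ˡ_)
open import Data.Sum using (_⊎_; inj₁; inj₂)
open import Data.Product using (_×_; ∃-syntax; _,_)
open import Data.List using (List; []; _∷_; filter; length; map; upTo; foldr)
open import Data.List.Relation.Unary.All using (All)
open import Data.List.Relation.Unary.Any using (Any)
open import Data.List.Relation.Unary.AllPairs using (AllPairs)
open import Function.Bundles using (_↔_; Inverse)
open import Relation.Binary.PropositionalEquality using (_≡_; _≢_)
open import Relation.Nullary using (¬_; yes; no)
open import Relation.Nullary.Decidable using (_×-dec_)

_^[_] : {A : Set} → (A → A) → ℕ → A → A
(f ^[ zero ]) x = x
(f ^[ suc k ]) x = f ((f ^[ k ]) x)

-- natural-number quotient, with the (unused) convention m ÷ 0 = 0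
_÷_ : ℕ → ℕ → ℕ
m ÷ zero = zero
m ÷ suc k = m / suc k

neg1^ : ℕ → ℤ
neg1^ zero = + 1
neg1^ (suc k) = - neg1^ k

sumℤ : List ℤ → ℤ
sumℤ = foldr ℤ._+_ (+ 0)

-- Möbius function: 0 if some prime square divides m, otherwise
-- (-1)^(number of distinct prime divisors of m).  (Primes dividing m ≥ 1
-- are ≤ m, so searching [0 .. m] is exhaustive.)
μ : ℕ → ℤ
μ m with Data.List.Relation.Unary.Any.any? (λ p → prime? p ×-dec ((p * p) ∣? m)) (upTo (suc m))
... | yes _ = + 0
... | no  _ = neg1^ (length (filter (λ p → prime? p ×-dec (p ∣? m)) (upTo (suc m))))

-- The directed bouquet B⃗ₙ.
-- Neighbourhood of the centre c: inj₁ i = b_i (black), inj₂ i = w_i (white).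
-- The vertices b_i, w_i have degree 2, so their rotations are forced; a map
-- is therefore determined by the rotation at c.

NC : ℕ → Set
NC n = Fin n ⊎ Fin n

IsSingleCycle : {n : ℕ} → (NC n ↔ NC n) → Set
IsSingleCycle ρ = ∀ x y → ∃[ k ] ((Inverse.to ρ ^[ k ]) x ≡ y)

record Map (n : ℕ) : Set where
  field
    rot    : NC n ↔ NC n
    single : IsSingleCycle rot
open Map public

lift : {n : ℕ} → (Fin n → Fin n) → NC n → NC n
lift f (inj₁ i) = inj₁ (f i)
lift f (inj₂ i) = inj₂ (f i)

actRot : {n : ℕ} → Permutation′ n → Map n → NC n → NC n
actRot σ M x = lift (σ ⟨$⟩ʳ_) (Inverse.to (rot M) (lift (σ ⟨$⟩ˡ_) x))

-- same S_n-orbit (same unlabeled imbedding)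
_~_ : {n : ℕ} → Map n → Map n → Set
_~_ {n} M M' = ∃[ σ ] (∀ x → actRot {n} σ M x ≡ Inverse.to (rot M') x)

-- σ lies in the map-automorphism group (stabilizer) of M
InStab : {n : ℕ} → Permutation′ n → Map n → Set
InStab σ M = ∀ x → actRot σ M x ≡ Inverse.to (rot M) x

AllCyclesLength : {n : ℕ} → ℕ → Permutation′ n → Set
AllCyclesLength d τ =
  ∀ i → ((τ ⟨$⟩ʳ_) ^[ d ]) i ≡ i × (∀ j → 0 < j → j < d → ((τ ⟨$⟩ʳ_) ^[ j ]) i ≢ i)

DFoldSymmetric : {n : ℕ} → ℕ → Map n → Set
DFoldSymmetric {n} d M =
  ∃[ τ ] (AllCyclesLength d τ ×
          (∀ (σ : Permutation′ n) →
             (InStab σ M → ∃[ j ] (j < d × (∀ i → σ ⟨$⟩ʳ i ≡ ((τ ⟨$⟩ʳ_) ^[ j ]) i)))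
           × (∃[ j ] (j < d × (∀ i → σ ⟨$⟩ʳ i ≡ ((τ ⟨$⟩ʳ_) ^[ j ]) i)) → InStab σ M)))

-- rs is a complete, irredundant system of representatives of the S_n-orbits
-- of maps satisfying P; its length is the number of such unlabeled imbeddings
IsOrbitTransversal : {n : ℕ} → (Map n → Set) → List (Map n) → Set
IsOrbitTransversal P rs =
  All P rs × (∀ M → P M → Any (λ R → M ~ R) rs) × AllPairs (λ R S → ¬ (R ~ S)) rs

formulaSum : ℕ → ℕ → ℤ
formulaSum n d =
  sumℤ (map (λ k → μ (k ÷ d) ℤ.* (+ ((((2 * n) ÷ k) ! * k ^ (n ÷ k)) ÷ ((n ÷ k) !))))
            (filter (λ k → (d ∣? k) ×-dec (k ∣? n)) (upTo (suc n))))

-- Reading a map from a base point around c and forgetting the names of the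
-- loops gives an oriented chord diagram: a 2n-periodic word whose letters are
-- the distance to the other end of the loop and the colour of the end. Maps in
-- the same S_n-orbit correspond to diagrams that differ by a rotation, and map
-- automorphisms to periods of the diagram, so d-fold symmetric maps are the
-- diagrams of minimal period 2n/d; each has 2n/d distinct rotations. A diagram
-- of period 2n/k is a diagram on 2n/k points with a voltage in ℤ/k on each
-- chord; choosing the mate of the first remaining point step by step there are
-- (2n/k)! k^{n/k} / (n/k)! of them. Möbius inversion over the periods finishes.

{-# OPTIONS --safe #-}
module Submission where

open import Defs
open import Level using (0ℓ)
open import Data.Nat
  using (ℕ; zero; suc; _+_; _*_; _∸_; _^_; _!; _≤_; _<_; z≤n; s≤s; NonZero; _≟_; _<?_; >-nonZero; >-nonZero⁻¹)
open import Data.Nat.Properties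
open import Data.Nat.DivMod
open import Data.Nat.Divisibility
open import Data.Nat.Primality
  using (Prime; prime?; euclidsLemma; prime⇒nonZero; prime⇒irreducible; prime⇒nonTrivial)
open import Data.Nat.Primality.Factorisation using (factorise)
import Data.Nat.Solver
open import Data.Integer as ℤ using (ℤ; +_; -_)
import Data.Integer.Properties as ℤₚ
open import Data.Integer.Solver using (module +-*-Solver)
open import Data.Bool using (Bool; true; false; not)
import Data.Bool.Properties as Boolₚ
open import Data.Fin using (Fin; zero; suc; toℕ; fromℕ<; punchIn; punchOut)
import Data.Fin.Properties as Finₚ
open import Data.Fin.Permutation using (Permutation′; _⟨$⟩ʳ_; _⟨$⟩ˡ_; inverseˡ; inverseʳ)
open import Data.Sum using (_⊎_; inj₁; inj₂)
import Data.Sum.Properties as Sumₚ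
open import Data.Product using (Σ-syntax; ∃-syntax; _×_; _,_; proj₁; proj₂)
import Data.Product.Properties as Productₚ
open import Data.Empty using (⊥)
open import Data.Unit using (⊤; tt)
open import Data.List
  using (List; []; _∷_; _++_; filter; length; map; upTo; allFin; applyUpTo; cartesianProduct; lookup)
import Data.List.Properties as Listₚ
open import Data.List.Relation.Unary.All as All using (All; []; _∷_)
open import Data.List.Relation.Unary.Any as Any using (Any; here; there)
import Data.List.Relation.Unary.Any.Properties as Anyₚ
open import Data.List.Relation.Unary.AllPairs as AllPairs using (AllPairs; []; _∷_)
import Data.List.Relation.Unary.AllPairs.Properties as AllPairsₚ
open import Data.List.Membership.Propositional using (_∈_; find)
open import Data.List.Membership.Propositional.Properties
open import Data.List.Membership.Propositional.Properties.WithK using (unique∧set⇒bag)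
import Data.List.Membership.Setoid as SetoidMembership
import Data.List.Membership.Setoid.Properties as SetoidMembershipₚ
open import Data.List.Relation.Unary.Unique.Propositional using (Unique)
import Data.List.Relation.Unary.Unique.Propositional.Properties as Uniqueₚ
import Data.List.Relation.Unary.Unique.Setoid as SetoidUnique
import Data.List.Relation.Unary.Unique.Setoid.Properties as SetoidUniqueₚ
open import Data.List.Relation.Binary.BagAndSetEquality using (∼bag⇒↭)
open import Data.List.Relation.Binary.Permutation.Propositional using (_↭_; refl; prep; swap; trans)
open import Data.List.Relation.Binary.Permutation.Propositional.Properties using (↭-length)
open import Function.Base using (_∘_; id; case_of_)
open import Function.Bundles using (Inverse; mk⇔; mk↔ₛ′)
open import Relation.Binary.Bundles using (Setoid)
open import Relation.Binary.PropositionalEquality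
  using (_≡_; _≢_; refl; sym; cong; cong₂; subst; module ≡-Reasoning)
import Relation.Binary.PropositionalEquality as ≡
open import Relation.Nullary using (¬_; Dec; yes; no; contradiction)
open import Relation.Nullary.Decidable using (_×-dec_; ¬?)

-- A base point makes a map rigid: a relabelling of the loops that respects the base points exists
-- exactly when the two words agree letter by letter. So no orbit-counting lemma is needed, and the
-- size of a rotation class is read off from the minimal period. Displacements are integers, and the
-- two displacements of a chord add up to exactly 2n. When positions are reduced modulo p = 2n/k,
-- the quotient of a displacement by p survives, and this is the voltage. The orientation keeps the
-- count uniform. The ends of a chord have opposite colours, while points in one residue class have
-- the same colour; hence no chord joins a point to one of its own translates, and p is even. With p
-- = 2m the mates can be chosen in (2m-1)(2m-3)...1 ways, and each of the m chords has 2 colourings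
-- and k voltages, which gives (2m-1)!! 2^m k^m = (2m)! k^m / m!.

-- Finite integer sums over lists

Σℤ : {A : Set} → (A → ℤ) → List A → ℤ
Σℤ f xs = sumℤ (map f xs)

module _ {A : Set} where

  unique∧set⇒↭ : {xs ys : List A} → Unique xs → Unique ys →
    (∀ {x} → x ∈ xs → x ∈ ys) → (∀ {x} → x ∈ ys → x ∈ xs) → xs ↭ ys
  unique∧set⇒↭ u v f g = ∼bag⇒↭ (unique∧set⇒bag u v (mk⇔ f g))

  Σℤ-↭ : (f : A → ℤ) {xs ys : List A} → xs ↭ ys → Σℤ f xs ≡ Σℤ f ys
  Σℤ-↭ f refl = refl
  Σℤ-↭ f (prep x p) = cong (ℤ._+_ (f x)) (Σℤ-↭ f p)
  Σℤ-↭ f (swap {xs} {ys} x y p) = ≡.trans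
    (cong (λ s → f x ℤ.+ (f y ℤ.+ s)) (Σℤ-↭ f p))
    (solve 3 (λ a b c → a :+ (b :+ c) := b :+ (a :+ c)) refl (f x) (f y) (Σℤ f ys))
    where open +-*-Solver
  Σℤ-↭ f (trans p q) = ≡.trans (Σℤ-↭ f p) (Σℤ-↭ f q)

  Σℤ-cong : {f g : A → ℤ} (xs : List A) → (∀ {x} → x ∈ xs → f x ≡ g x) → Σℤ f xs ≡ Σℤ g xs
  Σℤ-cong [] e = refl
  Σℤ-cong (x ∷ xs) e = cong₂ ℤ._+_ (e (here refl)) (Σℤ-cong xs (e ∘ there))

  Σℤ-zero : (xs : List A) → Σℤ (λ _ → + 0) xs ≡ + 0
  Σℤ-zero [] = refl
  Σℤ-zero (x ∷ xs) = ≡.trans (ℤₚ.+-identityˡ _) (Σℤ-zero xs)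

  Σℤ-neg : (f : A → ℤ) (xs : List A) → Σℤ (λ x → - f x) xs ≡ - Σℤ f xs
  Σℤ-neg f [] = refl
  Σℤ-neg f (x ∷ xs) = ≡.trans (cong (ℤ._+_ (- f x)) (Σℤ-neg f xs)) (sym (ℤₚ.neg-distrib-+ (f x) _))

  Σℤ-+ : (f g : A → ℤ) (xs : List A) → Σℤ (λ x → f x ℤ.+ g x) xs ≡ Σℤ f xs ℤ.+ Σℤ g xs
  Σℤ-+ f g [] = refl
  Σℤ-+ f g (x ∷ xs) = ≡.trans (cong (ℤ._+_ (f x ℤ.+ g x)) (Σℤ-+ f g xs))
    (solve 4 (λ a b c d → a :+ b :+ (c :+ d) := a :+ c :+ (b :+ d)) refl (f x) (g x) (Σℤ f xs) (Σℤ g xs))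
    where open +-*-Solver

  Σℤ-* : (c : ℤ) (f : A → ℤ) (xs : List A) → Σℤ (λ x → c ℤ.* f x) xs ≡ c ℤ.* Σℤ f xs
  Σℤ-* c f [] = sym (ℤₚ.*-zeroʳ c)
  Σℤ-* c f (x ∷ xs) = ≡.trans (cong (ℤ._+_ (c ℤ.* f x)) (Σℤ-* c f xs)) (sym (ℤₚ.*-distribˡ-+ c (f x) _))

  module _ {P : A → Set} (P? : ∀ x → Dec (P x)) where

    Σℤ-split : (f : A → ℤ) (xs : List A) →
      Σℤ f xs ≡ Σℤ f (filter P? xs) ℤ.+ Σℤ f (filter (¬? ∘ P?) xs)
    Σℤ-split f [] = refl
    Σℤ-split f (x ∷ xs) with P? x
    ... | yes _ = ≡.trans (cong (ℤ._+_ (f x)) (Σℤ-split f xs)) (sym (ℤₚ.+-assoc (f x) _ _))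
    ... | no _ = ≡.trans (cong (ℤ._+_ (f x)) (Σℤ-split f xs))
      (solve 3 (λ a b c → a :+ (b :+ c) := b :+ (a :+ c)) refl (f x) (Σℤ f (filter P? xs)) _)
      where open +-*-Solver

Σℤ-swap : {A B : Set} (f : A → B → ℤ) (xs : List A) (ys : List B) →
  Σℤ (λ x → Σℤ (f x) ys) xs ≡ Σℤ (λ y → Σℤ (λ x → f x y) xs) ys
Σℤ-swap f [] ys = sym (Σℤ-zero ys)
Σℤ-swap f (x ∷ xs) ys = ≡.trans (cong (ℤ._+_ (Σℤ (f x) ys)) (Σℤ-swap f xs ys))
  (sym (Σℤ-+ (f x) (λ y → Σℤ (λ x → f x y) xs) ys))

indicator : {P : Set} → Dec P → ℤ
indicator (yes _) = + 1
indicator (no _) = + 0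

Σℤ-indicator : {A : Set} {P : A → Set} (P? : ∀ x → Dec (P x)) (xs : List A) →
  Σℤ (indicator ∘ P?) xs ≡ + length (filter P? xs)
Σℤ-indicator P? [] = refl
Σℤ-indicator P? (x ∷ xs) with P? x
... | yes _ = cong (ℤ._+_ (+ 1)) (Σℤ-indicator P? xs)
... | no _ = ≡.trans (ℤₚ.+-identityˡ _) (Σℤ-indicator P? xs)

indicator-yes : {P : Set} (d : Dec P) → P → indicator d ≡ + 1
indicator-yes (yes _) p = refl
indicator-yes (no ¬p) p = contradiction p ¬p

indicator-no : {P : Set} (d : Dec P) → ¬ P → indicator d ≡ + 0
indicator-no (yes p) ¬p = contradiction p ¬p
indicator-no (no _) ¬p = refl

Σℤ-filter : {A : Set} {P : A → Set} (P? : ∀ x → Dec (P x)) (f : A → ℤ) (xs : List A) →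
  Σℤ (λ x → f x ℤ.* indicator (P? x)) xs ≡ Σℤ f (filter P? xs)
Σℤ-filter P? f [] = refl
Σℤ-filter P? f (x ∷ xs) with P? x
... | yes _ = cong₂ ℤ._+_ (ℤₚ.*-identityʳ (f x)) (Σℤ-filter P? f xs)
... | no _ = ≡.trans (cong₂ ℤ._+_ (ℤₚ.*-zeroʳ (f x)) (Σℤ-filter P? f xs)) (ℤₚ.+-identityˡ _)

-- Möbius inversion

∣-nonZero : ∀ {e m} .{{_ : NonZero m}} → e ∣ m → NonZero e
∣-nonZero {zero} {suc m} 0∣m = case 0∣⇒≡0 0∣m of λ ()
∣-nonZero {suc e} _ = _

divisors : ℕ → List ℕ
divisors m = filter (_∣? m) (upTo (suc m))

∈-divisors⁺ : ∀ {m e} .{{_ : NonZero m}} → e ∣ m → e ∈ divisors m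
∈-divisors⁺ {m} e∣m = ∈-filter⁺ (_∣? m) (∈-upTo⁺ (s≤s (∣⇒≤ e∣m))) e∣m

∈-divisors⁻ : ∀ m {e} → e ∈ divisors m → e ∣ m
∈-divisors⁻ m e∈ = proj₂ (∈-filter⁻ (_∣? m) {xs = upTo (suc m)} e∈)

divisors-unique : ∀ m → Unique (divisors m)
divisors-unique m = Uniqueₚ.filter⁺ (_∣? m) (Uniqueₚ.upTo⁺ (suc m))

primeDivisors : ℕ → List ℕ
primeDivisors m = filter (λ p → prime? p ×-dec (p ∣? m)) (upTo (suc m))

∈-primeDivisors⁺ : ∀ {m p} .{{_ : NonZero m}} → Prime p → p ∣ m → p ∈ primeDivisors m
∈-primeDivisors⁺ {m} pp p∣m = ∈-filter⁺ (λ p → prime? p ×-dec (p ∣? m)) (∈-upTo⁺ (s≤s (∣⇒≤ p∣m))) (pp , p∣m)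

∈-primeDivisors⁻ : ∀ m {p} → p ∈ primeDivisors m → Prime p × p ∣ m
∈-primeDivisors⁻ m p∈ = proj₂ (∈-filter⁻ (λ p → prime? p ×-dec (p ∣? m)) {xs = upTo (suc m)} p∈)

primeDivisors-unique : ∀ m → Unique (primeDivisors m)
primeDivisors-unique m = Uniqueₚ.filter⁺ (λ p → prime? p ×-dec (p ∣? m)) (Uniqueₚ.upTo⁺ (suc m))

Squarefree : ℕ → Set
Squarefree m = ∀ {q} → Prime q → ¬ (q * q ∣ m)

squareDivisor∈upTo : ∀ {m q} .{{_ : NonZero m}} → Prime q → q * q ∣ m → q ∈ upTo (suc m)
squareDivisor∈upTo {m} {q} pq q²∣m =
  ∈-upTo⁺ (s≤s (∣⇒≤ (∣-trans (m∣m*n q) q²∣m)))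

μ-square : ∀ {m p} .{{_ : NonZero m}} → Prime p → p * p ∣ m → μ m ≡ + 0
μ-square {m} {p} pp p²∣m with Any.any? (λ p → prime? p ×-dec ((p * p) ∣? m)) (upTo (suc m))
... | yes _ = refl
... | no ¬any = contradiction (Any.map (λ { refl → pp , p²∣m }) (squareDivisor∈upTo pp p²∣m)) ¬any

μ-squarefree : ∀ {m} → Squarefree m → μ m ≡ neg1^ (length (primeDivisors m))
μ-squarefree {m} sf with Any.any? (λ p → prime? p ×-dec ((p * p) ∣? m)) (upTo (suc m))
... | yes any = let (_ , pq , q²∣m) = Any.satisfied any in contradiction q²∣m (sf pq)
... | no _ = refl

squarefree? : ∀ m .{{_ : NonZero m}} → Squarefree m ⊎ (∃[ q ] (Prime q × q * q ∣ m))
squarefree? m with Any.any? (λ p → prime? p ×-dec ((p * p) ∣? m)) (upTo (suc m))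
... | yes any = inj₂ (Any.satisfied any)
... | no ¬any = inj₁ λ pq q²∣m → ¬any (Any.map (λ { refl → pq , q²∣m }) (squareDivisor∈upTo pq q²∣m))

prime∣prime⇒≡ : ∀ {p q} → Prime p → Prime q → p ∣ q → p ≡ q
prime∣prime⇒≡ pp pq p∣q with prime⇒irreducible pq p∣q
... | inj₂ p≡q = p≡q
... | inj₁ refl with () ← prime⇒nonTrivial pp

prime∣cancel : ∀ {p q e} → Prime p → Prime q → q ≢ p → q ∣ p * e → q ∣ e
prime∣cancel {p} {q} {e} pp pq q≢p q∣pe with euclidsLemma p e pq q∣pe
... | inj₁ q∣p = contradiction (prime∣prime⇒≡ pq pp q∣p) q≢p
... | inj₂ q∣e = q∣e

-- For `q = p`, cancelling `p` would give `p ∣ e`. For `q ≠ p`, both factors `q` pass through `p`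
-- into `e`.
squarefree-prime-* : ∀ {p e} → Prime p → ¬ (p ∣ e) → Squarefree e → Squarefree (p * e)
squarefree-prime-* {p} {e} pp p∤e sf {q} pq q²∣pe with q ≟ p
... | yes refl = p∤e (*-cancelˡ-∣ p {{prime⇒nonZero pp}} q²∣pe)
... | no q≢p with prime∣cancel pp pq q≢p (∣-trans (m∣m*n q) q²∣pe)
...   | divides r refl = sf pq (subst (q * q ∣_) (*-comm q r)
  (*-monoʳ-∣ q (prime∣cancel pp pq q≢p (*-cancelˡ-∣ q {{prime⇒nonZero pq}} (subst (q * q ∣_) lemma q²∣pe)))))
  where
  lemma : p * (r * q) ≡ q * (p * r)
  lemma = ≡.trans (sym (*-assoc p r q)) (*-comm (p * r) q)

-- The factor `p` adds one prime divisor and no square, which flips the sign. If `e` has a square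
-- divisor, both sides are 0.
μ-prime-* : ∀ {p e} .{{_ : NonZero e}} → Prime p → ¬ (p ∣ e) → μ (p * e) ≡ - μ e
μ-prime-* {p} {e} pp p∤e = go (squarefree? e)
  where
  instance
    p≢0 : NonZero p
    p≢0 = prime⇒nonZero pp
    pe≢0 : NonZero (p * e)
    pe≢0 = m*n≢0 p e
  ps : primeDivisors (p * e) ↭ p ∷ primeDivisors e
  ps = unique∧set⇒↭ (primeDivisors-unique (p * e))
    (All.tabulate (λ { q∈ refl → p∤e (proj₂ (∈-primeDivisors⁻ e q∈)) }) ∷ primeDivisors-unique e)
    to from
    where
    to : ∀ {q} → q ∈ primeDivisors (p * e) → q ∈ p ∷ primeDivisors e
    to {q} q∈ with q ≟ p | ∈-primeDivisors⁻ (p * e) q∈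
    ... | yes refl | _ = here refl
    ... | no q≢p | pq , q∣pe = there (∈-primeDivisors⁺ pq (prime∣cancel pp pq q≢p q∣pe))
    from : ∀ {q} → q ∈ p ∷ primeDivisors e → q ∈ primeDivisors (p * e)
    from (here refl) = ∈-primeDivisors⁺ pp (m∣m*n e)
    from (there q∈) = let pq , q∣e = ∈-primeDivisors⁻ e q∈ in ∈-primeDivisors⁺ pq (∣n⇒∣m*n p q∣e)
  go : Squarefree e ⊎ (∃[ q ] (Prime q × q * q ∣ e)) → μ (p * e) ≡ - μ e
  go (inj₁ sf) = begin
    μ (p * e) ≡⟨ μ-squarefree (squarefree-prime-* pp p∤e sf) ⟩
    neg1^ (length (primeDivisors (p * e))) ≡⟨ cong neg1^ (↭-length ps) ⟩
    - neg1^ (length (primeDivisors e)) ≡⟨ cong -_ (sym (μ-squarefree sf)) ⟩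
    - μ e ∎
    where open ≡-Reasoning
  go (inj₂ (q , pq , q²∣e)) = ≡.trans (μ-square pq (∣n⇒∣m*n p q²∣e)) (cong -_ (sym (μ-square pq q²∣e)))

primeDivisor : ∀ t → 1 < t → ∃[ p ] (Prime p × p ∣ t)
primeDivisor (suc (suc t)) _ with factorise (suc (suc t))
... | record { factors = [] ; isFactorisation = () }
... | record { factors = p ∷ ps ; isFactorisation = eq ; factorsPrime = pp ∷ _ } =
  p , pp , subst (p ∣_) (sym eq) (m∣m*n _)
primeDivisor (suc zero) (s≤s ())

-- For a prime p ∣ t, the divisors e and p e with p ∤ e cancel, and μ vanishes on the remaining divisors.
Σμ-divisors : ∀ t → 1 < t → Σℤ μ (divisors t) ≡ + 0
Σμ-divisors t 1<t with primeDivisor t 1<t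
... | p , pp , divides t′ eq = begin
  Σℤ μ (divisors t)
    ≡⟨ Σℤ-split (p ∣?_) μ (divisors t) ⟩
  Σℤ μ (filter (p ∣?_) (divisors t)) ℤ.+ Σℤ μ (filter (¬? ∘ (p ∣?_)) (divisors t))
    ≡⟨ cong₂ ℤ._+_ multiples (Σℤ-↭ μ coprimes) ⟩
  - Σℤ μ (filter (¬? ∘ (p ∣?_)) (divisors t′)) ℤ.+ Σℤ μ (filter (¬? ∘ (p ∣?_)) (divisors t′))
    ≡⟨ ℤₚ.+-inverseˡ (Σℤ μ (filter (¬? ∘ (p ∣?_)) (divisors t′))) ⟩
  + 0 ∎
  where
  open ≡-Reasoning
  instance
    p≢0 : NonZero p
    p≢0 = prime⇒nonZero pp
    t≢0 : NonZero t
    t≢0 = >-nonZero (<-trans (s≤s z≤n) 1<t)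
    t′≢0 : NonZero t′
    t′≢0 = ∣-nonZero (subst (t′ ∣_) (sym eq) (m∣m*n p))
  eq′ : t ≡ p * t′
  eq′ = ≡.trans eq (*-comm t′ p)

  coprimes : filter (¬? ∘ (p ∣?_)) (divisors t) ↭ filter (¬? ∘ (p ∣?_)) (divisors t′)
  coprimes = unique∧set⇒↭ (Uniqueₚ.filter⁺ _ (divisors-unique t)) (Uniqueₚ.filter⁺ _ (divisors-unique t′)) to from
    where
    to : ∀ {e} → e ∈ filter (¬? ∘ (p ∣?_)) (divisors t) → e ∈ filter (¬? ∘ (p ∣?_)) (divisors t′)
    to {e} e∈ with ∈-filter⁻ (¬? ∘ (p ∣?_)) {xs = divisors t} e∈
    ... | e∈D , p∤e with subst (e ∣_) eq′ (∈-divisors⁻ t e∈D)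
    ... | divides r pt′≡re with euclidsLemma r e pp (subst (p ∣_) pt′≡re (m∣m*n t′))
    ... | inj₂ p∣e = contradiction p∣e p∤e
    ... | inj₁ (divides s refl) = ∈-filter⁺ (¬? ∘ (p ∣?_)) (∈-divisors⁺ (divides s
      (*-cancelˡ-≡ _ _ p (≡.trans pt′≡re (≡.trans (cong (_* e) (*-comm s p)) (*-assoc p s e)))))) p∤e
    from : ∀ {e} → e ∈ filter (¬? ∘ (p ∣?_)) (divisors t′) → e ∈ filter (¬? ∘ (p ∣?_)) (divisors t)
    from {e} e∈ with ∈-filter⁻ (¬? ∘ (p ∣?_)) {xs = divisors t′} e∈
    ... | e∈D , p∤e = ∈-filter⁺ (¬? ∘ (p ∣?_))
      (∈-divisors⁺ (subst (e ∣_) (sym eq′) (∣n⇒∣m*n p (∈-divisors⁻ t′ e∈D)))) p∤e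

  image : filter (p ∣?_) (divisors t) ↭ map (p *_) (divisors t′)
  image = unique∧set⇒↭ (Uniqueₚ.filter⁺ _ (divisors-unique t))
    (Uniqueₚ.map⁺ (*-cancelˡ-≡ _ _ p) (divisors-unique t′)) to from
    where
    to : ∀ {e} → e ∈ filter (p ∣?_) (divisors t) → e ∈ map (p *_) (divisors t′)
    to {e} e∈ with ∈-filter⁻ (p ∣?_) {xs = divisors t} e∈
    ... | e∈D , divides r refl = subst (_∈ map (p *_) (divisors t′)) (*-comm p r)
      (∈-map⁺ (p *_) (∈-divisors⁺ (*-cancelʳ-∣ p (subst (r * p ∣_) eq (∈-divisors⁻ t e∈D)))))
    from : ∀ {e} → e ∈ map (p *_) (divisors t′) → e ∈ filter (p ∣?_) (divisors t)
    from e∈ with ∈-map⁻ (p *_) e∈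
    ... | r , r∈D , refl = ∈-filter⁺ (p ∣?_)
      (∈-divisors⁺ (subst (p * r ∣_) (sym eq′) (*-monoʳ-∣ p (∈-divisors⁻ t′ r∈D)))) (m∣m*n r)

  e≢0 : ∀ {e} → e ∈ divisors t′ → NonZero e
  e≢0 e∈ = ∣-nonZero (∈-divisors⁻ t′ e∈)

  multiples : Σℤ μ (filter (p ∣?_) (divisors t)) ≡ - Σℤ μ (filter (¬? ∘ (p ∣?_)) (divisors t′))
  multiples = begin
    Σℤ μ (filter (p ∣?_) (divisors t))
      ≡⟨ Σℤ-↭ μ image ⟩
    Σℤ μ (map (p *_) (divisors t′))
      ≡⟨ cong sumℤ (sym (Listₚ.map-∘ (divisors t′))) ⟩
    Σℤ (λ e → μ (p * e)) (divisors t′)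
      ≡⟨ Σℤ-split (p ∣?_) (λ e → μ (p * e)) (divisors t′) ⟩
    Σℤ (λ e → μ (p * e)) (filter (p ∣?_) (divisors t′)) ℤ.+ Σℤ (λ e → μ (p * e)) (filter (¬? ∘ (p ∣?_)) (divisors t′))
      ≡⟨ cong₂ ℤ._+_
          (Σℤ-cong (filter (p ∣?_) (divisors t′)) λ {e} e∈ →
            let e∈D , p∣e = ∈-filter⁻ (p ∣?_) {xs = divisors t′} e∈
            in μ-square {{m*n≢0 p e {{p≢0}} {{e≢0 e∈D}}}} pp (*-monoʳ-∣ p p∣e))
          (Σℤ-cong (filter (¬? ∘ (p ∣?_)) (divisors t′)) λ e∈ →
            let e∈D , p∤e = ∈-filter⁻ (¬? ∘ (p ∣?_)) {xs = divisors t′} e∈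
            in μ-prime-* {{e≢0 e∈D}} pp p∤e) ⟩
    Σℤ (λ _ → + 0) (filter (p ∣?_) (divisors t′)) ℤ.+ Σℤ (λ e → - μ e) (filter (¬? ∘ (p ∣?_)) (divisors t′))
      ≡⟨ cong₂ ℤ._+_ (Σℤ-zero (filter (p ∣?_) (divisors t′))) (Σℤ-neg μ (filter (¬? ∘ (p ∣?_)) (divisors t′))) ⟩
    + 0 ℤ.+ - Σℤ μ (filter (¬? ∘ (p ∣?_)) (divisors t′))
      ≡⟨ ℤₚ.+-identityˡ _ ⟩
    - Σℤ μ (filter (¬? ∘ (p ∣?_)) (divisors t′)) ∎

m*n÷m≡n : ∀ m n .{{_ : NonZero m}} → (m * n) ÷ m ≡ n
m*n÷m≡n (suc m) n = ≡.trans (cong (λ x → x / suc m) (*-comm (suc m) n)) (m*n/n≡m n (suc m))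

intervalDivisors : ℕ → ℕ → List ℕ
intervalDivisors d n = filter (λ k → (d ∣? k) ×-dec (k ∣? n)) (upTo (suc n))

∈-intervalDivisors⁻ : ∀ {d n k} → k ∈ intervalDivisors d n → d ∣ k × k ∣ n
∈-intervalDivisors⁻ {d} {n} k∈ = proj₂ (∈-filter⁻ (λ k → (d ∣? k) ×-dec (k ∣? n)) {xs = upTo (suc n)} k∈)

-- Only the `k` with `d ∣ k ∣ s` survive the indicator. With `s = t * d` and `k = d * e` they
-- correspond to the divisors `e` of `t`, over which `μ` sums to 1 if `t = 1` and to 0 otherwise.
möbius-inversion : ∀ {d n s} .{{_ : NonZero n}} → d ∣ n → s ∣ n →
  Σℤ (λ k → μ (k ÷ d) ℤ.* indicator (k ∣? s)) (intervalDivisors d n) ≡ indicator (s ≟ d)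
möbius-inversion {d} {n} {s} d∣n s∣n = ≡.trans (Σℤ-filter (_∣? s) (λ k → μ (k ÷ d)) (intervalDivisors d n)) (go (d ∣? s))
  where
  instance
    d≢0 : NonZero d
    d≢0 = ∣-nonZero d∣n
    s≢0 : NonZero s
    s≢0 = ∣-nonZero s∣n
  K = filter (_∣? s) (intervalDivisors d n)
  K⁻ : ∀ {k} → k ∈ K → d ∣ k × k ∣ s
  K⁻ k∈ = let k∈I , k∣s = ∈-filter⁻ (_∣? s) {xs = intervalDivisors d n} k∈ in proj₁ (∈-intervalDivisors⁻ {d} {n} k∈I) , k∣s
  K-unique : Unique K
  K-unique = Uniqueₚ.filter⁺ (_∣? s) (Uniqueₚ.filter⁺ (λ k → (d ∣? k) ×-dec (k ∣? n)) (Uniqueₚ.upTo⁺ (suc n)))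
  go : Dec (d ∣ s) → Σℤ (λ k → μ (k ÷ d)) K ≡ indicator (s ≟ d)
  -- `K` is empty in this case, so its terms agree with 0 vacuously.
  go (no d∤s) = ≡.trans (Σℤ-cong K (λ k∈ → contradiction (let d∣k , k∣s = K⁻ k∈ in ∣-trans d∣k k∣s) d∤s))
    (≡.trans (Σℤ-zero K) (sym (indicator-no (s ≟ d) λ { refl → d∤s ∣-refl })))
  go (yes (divides t refl)) = begin
    Σℤ (λ k → μ (k ÷ d)) K ≡⟨ Σℤ-↭ (λ k → μ (k ÷ d)) K↭ ⟩
    Σℤ (λ k → μ (k ÷ d)) (map (d *_) (divisors t))
      ≡⟨ cong sumℤ (sym (Listₚ.map-∘ {g = λ k → μ (k ÷ d)} {f = d *_} (divisors t))) ⟩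
    Σℤ (λ e → μ ((d * e) ÷ d)) (divisors t) ≡⟨ Σℤ-cong (divisors t) (λ {e} _ → cong μ (m*n÷m≡n d e)) ⟩
    Σℤ μ (divisors t) ≡⟨ last t refl ⟩
    indicator (t * d ≟ d) ∎
    where
    open ≡-Reasoning
    instance
      t≢0 : NonZero t
      t≢0 = ∣-nonZero {m = t * d} (m∣m*n d)
    K↭ : K ↭ map (d *_) (divisors t)
    K↭ = unique∧set⇒↭ K-unique (Uniqueₚ.map⁺ (*-cancelˡ-≡ _ _ d) (divisors-unique t)) to from
      where
      to : ∀ {k} → k ∈ K → k ∈ map (d *_) (divisors t)
      to k∈ with K⁻ k∈
      ... | divides e refl , k∣s = subst (_∈ map (d *_) (divisors t)) (*-comm d e)
        (∈-map⁺ (d *_) (∈-divisors⁺ {t} (*-cancelʳ-∣ {e} {t} d k∣s)))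
      from : ∀ {k} → k ∈ map (d *_) (divisors t) → k ∈ K
      from k∈ with ∈-map⁻ (d *_) k∈
      ... | e , e∈ , refl = ∈-filter⁺ (_∣? t * d) (∈-filter⁺ (λ k → (d ∣? k) ×-dec (k ∣? n))
          (∈-upTo⁺ (s≤s (∣⇒≤ de∣n))) (m∣m*n e , de∣n)) de∣s
        where
        de∣s : d * e ∣ t * d
        de∣s = subst (d * e ∣_) (*-comm d t) (*-monoʳ-∣ d (∈-divisors⁻ t e∈))
        de∣n = ∣-trans de∣s s∣n
    last : ∀ t′ → t ≡ t′ → Σℤ μ (divisors t) ≡ indicator (t * d ≟ d)
    last zero refl with () ← t≢0
    last (suc zero) refl = sym (indicator-yes (1 * d ≟ d) (*-identityˡ d))
    last (suc (suc t′)) refl = ≡.trans (Σμ-divisors t (s≤s (s≤s z≤n)))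
      (sym (indicator-no (t * d ≟ d) λ eq → case *-cancelʳ-≡ t 1 d (≡.trans eq (sym (*-identityˡ d))) of λ ()))

-- Words of oriented chord diagrams

%-absorbˡ : ∀ a b p .{{_ : NonZero p}} → (a % p + b) % p ≡ (a + b) % p
%-absorbˡ a b p = begin
  (a % p + b) % p ≡⟨ %-distribˡ-+ (a % p) b p ⟩
  (a % p % p + b % p) % p ≡⟨ cong (λ x → (x + b % p) % p) (m%n%n≡m%n a p) ⟩
  (a % p + b % p) % p ≡⟨ sym (%-distribˡ-+ a b p) ⟩
  (a + b) % p ∎
  where open ≡-Reasoning

-- A letter records the distance to the other end of the chord and the colour
-- of the current end (false: black, true: white).
Letter : Set
Letter = ℕ × Bool

disp : Letter → ℕ
disp = proj₁

colour : Letter → Bool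
colour = proj₂

not≢ : ∀ {b} → b ≢ not b
not≢ {false} ()
not≢ {true} ()

length-cartesianProduct : {A B : Set} (xs : List A) (ys : List B) →
  length (cartesianProduct xs ys) ≡ length xs * length ys
length-cartesianProduct [] ys = refl
length-cartesianProduct (x ∷ xs) ys = ≡.trans (Listₚ.length-++ (map (x ,_) ys))
  (cong₂ _+_ (Listₚ.length-map (x ,_) ys) (length-cartesianProduct xs ys))

module Decoding (p k : ℕ) .{{_ : NonZero p}} where

  -- The voltage v selects one of the k lifts of the residue y − x.
  offset : ℕ → ℕ → ℕ → ℕ
  offset x y v = (y + (p ∸ x)) % p + v * p

  offset-target : ∀ {x y} v → x < p → y < p → (x + offset x y v) % p ≡ y
  offset-target {x} {y} v x<p y<p = begin
    (x + ((y + (p ∸ x)) % p + v * p)) % p ≡⟨ cong (_% p) (sym (+-assoc x _ (v * p))) ⟩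
    (x + (y + (p ∸ x)) % p + v * p) % p ≡⟨ [m+kn]%n≡m%n (x + (y + (p ∸ x)) % p) v p ⟩
    (x + (y + (p ∸ x)) % p) % p ≡⟨ cong (_% p) (+-comm x _) ⟩
    ((y + (p ∸ x)) % p + x) % p ≡⟨ %-absorbˡ (y + (p ∸ x)) x p ⟩
    (y + (p ∸ x) + x) % p ≡⟨ cong (_% p) (+-assoc y (p ∸ x) x) ⟩
    (y + (p ∸ x + x)) % p ≡⟨ cong (λ z → (y + z) % p) (m∸n+n≡m (<⇒≤ x<p)) ⟩
    (y + p) % p ≡⟨ [m+n]%n≡m%n y p ⟩
    y % p ≡⟨ m<n⇒m%n≡m y<p ⟩
    y ∎
    where open ≡-Reasoning

  offset-< : ∀ x y {v} → v < k → offset x y v < k * p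
  offset-< x y {v} v<k = begin-strict
    (y + (p ∸ x)) % p + v * p <⟨ +-monoˡ-< (v * p) (m%n<n (y + (p ∸ x)) p) ⟩
    suc v * p ≤⟨ *-monoˡ-≤ p v<k ⟩
    k * p ∎
    where open ≤-Reasoning

  -- Division with remainder: the target fixes `δ % p`, and the voltage is `δ / p`.
  offset-cover : ∀ {x} δ → x < p → offset x ((x + δ) % p) (δ / p) ≡ δ
  offset-cover {x} δ x<p = begin
    ((x + δ) % p + (p ∸ x)) % p + δ / p * p ≡⟨ cong (_+ δ / p * p) (%-absorbˡ (x + δ) (p ∸ x) p) ⟩
    (x + δ + (p ∸ x)) % p + δ / p * p ≡⟨ cong (λ z → z % p + δ / p * p) lemma ⟩
    (δ + p) % p + δ / p * p ≡⟨ cong (_+ δ / p * p) ([m+n]%n≡m%n δ p) ⟩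
    δ % p + δ / p * p ≡⟨ sym (m≡m%n+[m/n]*n δ p) ⟩
    δ ∎
    where
    open ≡-Reasoning
    lemma : x + δ + (p ∸ x) ≡ δ + p
    lemma = begin
      x + δ + (p ∸ x) ≡⟨ cong (_+ (p ∸ x)) (+-comm x δ) ⟩
      δ + x + (p ∸ x) ≡⟨ +-assoc δ x (p ∸ x) ⟩
      δ + (x + (p ∸ x)) ≡⟨ cong (_+_ δ) (m+[n∸m]≡n (<⇒≤ x<p)) ⟩
      δ + p ∎

  offset-injective : ∀ {x y y′ v v′} → x < p → y < p → y′ < p →
    offset x y v ≡ offset x y′ v′ → y ≡ y′ × v ≡ v′
  offset-injective {x} {y} {y′} {v} {v′} x<p y<p y′<p eq = y≡y′ , v≡v′ y≡y′ eq
    where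
    y≡y′ : y ≡ y′
    y≡y′ = ≡.trans (sym (offset-target v x<p y<p))
      (≡.trans (cong (λ δ → (x + δ) % p) eq) (offset-target v′ x<p y′<p))
    v≡v′ : y ≡ y′ → offset x y v ≡ offset x y′ v′ → v ≡ v′
    v≡v′ refl eq = *-cancelʳ-≡ v v′ p (+-cancelˡ-≡ ((y + (p ∸ x)) % p) _ _ eq)

  -- `ε + δ` is a multiple of `p`, so `ε` is the negative of `δ` modulo `p`.
  mate-sym : ∀ {x y δ ε} → x < p → (x + δ) % p ≡ y → ε + δ ≡ k * p → (y + ε) % p ≡ x
  mate-sym {x} {y} {δ} {ε} x<p refl sum = begin
    ((x + δ) % p + ε) % p ≡⟨ %-absorbˡ (x + δ) ε p ⟩
    (x + δ + ε) % p ≡⟨ cong (_% p) (+-assoc x δ ε) ⟩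
    (x + (δ + ε)) % p ≡⟨ cong (λ z → (x + z) % p) (≡.trans (+-comm δ ε) sum) ⟩
    (x + k * p) % p ≡⟨ [m+kn]%n≡m%n x k p ⟩
    x % p ≡⟨ m<n⇒m%n≡m x<p ⟩
    x ∎
    where open ≡-Reasoning

  -- Codes of the diagrams on m points: the mate of the first point among the
  -- others, the colour of the first point, the voltage of its chord, and a code for the remaining points.
  Code : ℕ → Set
  Code zero = ⊤
  Code (suc zero) = ⊥
  Code (suc (suc m)) = Fin (suc m) × Bool × Fin k × Code m

  allCodes : ∀ m → List (Code m)
  allCodes zero = tt ∷ []
  allCodes (suc zero) = []
  allCodes (suc (suc m)) =
    cartesianProduct (allFin (suc m)) (cartesianProduct (false ∷ true ∷ []) (cartesianProduct (allFin k) (allCodes m)))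

  allCodes-unique : ∀ m → Unique (allCodes m)
  allCodes-unique zero = [] ∷ []
  allCodes-unique (suc zero) = []
  allCodes-unique (suc (suc m)) =
    Uniqueₚ.cartesianProduct⁺ (Uniqueₚ.allFin⁺ (suc m))
      (Uniqueₚ.cartesianProduct⁺ (((λ ()) ∷ []) ∷ [] ∷ [])
        (Uniqueₚ.cartesianProduct⁺ (Uniqueₚ.allFin⁺ k) (allCodes-unique m)))

  ∈-allCodes : ∀ m (a : Code m) → a ∈ allCodes m
  ∈-allCodes zero tt = here refl
  ∈-allCodes (suc (suc m)) (i , c , v , a) =
    ∈-cartesianProduct⁺ (∈-allFin i) (∈-cartesianProduct⁺ (bool c) (∈-cartesianProduct⁺ (∈-allFin v) (∈-allCodes m a)))
    where
    bool : ∀ c → c ∈ false ∷ true ∷ []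
    bool false = here refl
    bool true = there (here refl)

  length-allCodes-step : ∀ m → length (allCodes (2 + m)) ≡ suc m * (2 * (k * length (allCodes m)))
  length-allCodes-step m = begin
    length (allCodes (2 + m))
      ≡⟨ length-cartesianProduct (allFin (suc m)) (cartesianProduct (false ∷ true ∷ []) (cartesianProduct (allFin k) (allCodes m))) ⟩
    length (allFin (suc m)) * length (cartesianProduct (false ∷ true ∷ []) (cartesianProduct (allFin k) (allCodes m)))
      ≡⟨ cong₂ _*_ (Listₚ.length-tabulate {n = suc m} id)
          (length-cartesianProduct (false ∷ true ∷ []) (cartesianProduct (allFin k) (allCodes m))) ⟩
    suc m * (2 * length (cartesianProduct (allFin k) (allCodes m)))
      ≡⟨ cong (λ z → suc m * (2 * z)) (length-cartesianProduct (allFin k) (allCodes m)) ⟩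
    suc m * (2 * (length (allFin k) * length (allCodes m)))
      ≡⟨ cong (λ z → suc m * (2 * (z * length (allCodes m)))) (Listₚ.length-tabulate {n = k} id) ⟩
    suc m * (2 * (k * length (allCodes m))) ∎
    where open ≡-Reasoning

  -- The product form shows that the quotient by `m !` in the formula is exact.
  length-allCodes : ∀ m → (m !) * length (allCodes (2 * m)) ≡ ((2 * m) !) * k ^ m
  length-allCodes zero = refl
  length-allCodes (suc m) = begin
    (suc m !) * length (allCodes (2 * suc m))
      ≡⟨ cong (λ z → (suc m !) * length (allCodes z)) 2*suc ⟩
    (suc m !) * length (allCodes (2 + 2 * m))
      ≡⟨ cong ((suc m !) *_) (length-allCodes-step (2 * m)) ⟩
    suc m * (m !) * (suc (2 * m) * (2 * (k * G)))
      -- The colour factor 2 and the factor `suc m` on the left combine into the even factor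
      -- `2 + 2 * m` of the larger factorial.
      ≡⟨ solve 4 (λ m f k g → (con 1 :+ m) :* f :* ((con 1 :+ con 2 :* m) :* (con 2 :* (k :* g)))
          := (con 2 :+ con 2 :* m) :* (con 1 :+ con 2 :* m) :* k :* (f :* g)) refl m (m !) k G ⟩
    suc (suc (2 * m)) * suc (2 * m) * k * ((m !) * G)
      ≡⟨ cong (suc (suc (2 * m)) * suc (2 * m) * k *_) (length-allCodes m) ⟩
    suc (suc (2 * m)) * suc (2 * m) * k * (((2 * m) !) * k ^ m)
      ≡⟨ solve 5 (λ a b k f g → a :* b :* k :* (f :* g) := a :* (b :* f) :* (k :* g))
          refl (suc (suc (2 * m))) (suc (2 * m)) k ((2 * m) !) (k ^ m) ⟩
    ((2 + 2 * m) !) * k ^ suc m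
      ≡⟨ cong (λ z → (z !) * k ^ suc m) (sym 2*suc) ⟩
    ((2 * suc m) !) * k ^ suc m ∎
    where
    open ≡-Reasoning
    open Data.Nat.Solver.+-*-Solver
    G = length (allCodes (2 * m))
    2*suc : 2 * suc m ≡ 2 + 2 * m
    2*suc = *-suc 2 m

  -- Each chord uses up two points. This parity is what later improves `order u ∣ 2 * n` to
  -- `order u ∣ n`.
  Code⇒even : ∀ m → Code m → 2 ∣ m
  Code⇒even zero _ = 2 ∣0
  Code⇒even (suc (suc m)) (_ , _ , _ , a) = ∣m∣n⇒∣m+n ∣-refl (Code⇒even m a)

  -- The points still to be matched keep their original residues, so displacements computed at
  -- different depths of the recursion refer to the same circle.
  Positions : ℕ → Set
  Positions m = Fin m → ℕ

  remaining : ∀ {m} → Positions (2 + m) → Fin (suc m) → Positions m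
  remaining S i j = S (suc (punchIn i j))

  -- The two tests are arguments, so that a `with` on them evaluates the letter in the lemmas about
  -- `decode`.
  choose : {P Q : Set} → Dec P → Dec Q → Letter → Letter → Letter → Letter
  choose (yes _) _ a b c = a
  choose (no _) (yes _) a b c = b
  choose (no _) (no _) a b c = c

  decode : ∀ m → Positions m → Code m → ℕ → Letter
  -- Default away from the listed positions. `word` reads `decode` only at residues modulo `p`, all
  -- of which are listed.
  decode zero S _ z = 0 , false
  decode (suc (suc m)) S (i , c , v , a) z =
    choose (z ≟ S zero) (z ≟ S (suc i)) (δ , c) (k * p ∸ δ , not c) (decode m (remaining S i) a z)
    where δ = offset (S zero) (S (suc i)) (toℕ v)

  record Admissible {m} (S : Positions m) : Set where
    field
      bounded : ∀ j → S j < p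
      injective : ∀ {i j} → S i ≡ S j → i ≡ j
  open Admissible

  remaining-admissible : ∀ {m} {S : Positions (2 + m)} i → Admissible S → Admissible (remaining S i)
  remaining-admissible i ad .bounded j = ad .bounded (suc (punchIn i j))
  remaining-admissible i ad .injective eq = Finₚ.punchIn-injective i _ _ (Finₚ.suc-injective (ad .injective eq))

  module _ {m} {S : Positions (2 + m)} (ad : Admissible S) (i : Fin (suc m)) (c : Bool) (v : Fin k) (a : Code m) where

    private δ = offset (S zero) (S (suc i)) (toℕ v)

    decode-first : decode (2 + m) S (i , c , v , a) (S zero) ≡ (δ , c)
    decode-first with S zero ≟ S zero
    ... | yes _ = refl
    ... | no ≢ = contradiction refl ≢

    decode-mate : decode (2 + m) S (i , c , v , a) (S (suc i)) ≡ (k * p ∸ δ , not c)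
    decode-mate with S (suc i) ≟ S zero | S (suc i) ≟ S (suc i)
    ... | yes eq | _ = case ad .injective eq of λ ()
    ... | no _ | yes _ = refl
    ... | no _ | no ≢ = contradiction refl ≢

    decode-remaining : ∀ j → decode (2 + m) S (i , c , v , a) (remaining S i j) ≡ decode m (remaining S i) a (remaining S i j)
    decode-remaining j with remaining S i j ≟ S zero | remaining S i j ≟ S (suc i)
    ... | yes eq | _ = case ad .injective eq of λ ()
    ... | no _ | yes eq = contradiction (Finₚ.suc-injective (ad .injective eq)) (Finₚ.punchInᵢ≢i i j)
    ... | no _ | no _ = refl

  data View {m} (i : Fin (suc m)) : Fin (2 + m) → Set where
    first : View i zero
    mate : View i (suc i)
    rest : ∀ j → View i (suc (punchIn i j))

  view : ∀ {m} (i : Fin (suc m)) j → View i j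
  view i zero = first
  view i (suc j) with i Finₚ.≟ j
  ... | yes refl = mate
  ... | no i≢j = subst (View i ∘ suc) (Finₚ.punchIn-punchOut i≢j) (rest (punchOut i≢j))

  -- The sum is `k * p` itself and not just a multiple of it, so the displacement at one end fixes
  -- the other. Opposite colours exclude `j = j′`.
  Mated : ∀ {m} → Positions m → (ℕ → Letter) → Fin m → Fin m → Set
  Mated S u j j′ = (S j + disp (u (S j))) % p ≡ S j′ × disp (u (S j′)) + disp (u (S j)) ≡ k * p
    × colour (u (S j′)) ≡ not (colour (u (S j)))

  Closed : ∀ {m} → Positions m → (ℕ → Letter) → Set
  Closed S u = ∀ j → ∃[ j′ ] Mated S u j j′

  decode-closed : ∀ m {S : Positions m} → Admissible S → (a : Code m) → Closed S (decode m S a)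
  decode-closed (suc (suc m)) {S} ad (i , c , v , a) j with view i j
  ... | first rewrite decode-first ad i c v a = suc i , at-mate
    where
    δ = offset (S zero) (S (suc i)) (toℕ v)
    at-mate : (S zero + δ) % p ≡ S (suc i) × disp (decode (2 + m) S (i , c , v , a) (S (suc i))) + δ ≡ k * p
      × colour (decode (2 + m) S (i , c , v , a) (S (suc i))) ≡ not c
    at-mate rewrite decode-mate ad i c v a =
      offset-target (toℕ v) (ad .bounded zero) (ad .bounded (suc i)) ,
      m∸n+n≡m (<⇒≤ (offset-< (S zero) (S (suc i)) (Finₚ.toℕ<n v))) , refl
  ... | mate rewrite decode-mate ad i c v a = zero , at-first
    where
    δ = offset (S zero) (S (suc i)) (toℕ v)
    δ≤ : δ ≤ k * p
    δ≤ = <⇒≤ (offset-< (S zero) (S (suc i)) (Finₚ.toℕ<n v))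
    at-first : (S (suc i) + (k * p ∸ δ)) % p ≡ S zero × disp (decode (2 + m) S (i , c , v , a) (S zero)) + (k * p ∸ δ) ≡ k * p
      × colour (decode (2 + m) S (i , c , v , a) (S zero)) ≡ not (not c)
    at-first rewrite decode-first ad i c v a =
      mate-sym (ad .bounded zero) (offset-target (toℕ v) (ad .bounded zero) (ad .bounded (suc i))) (m∸n+n≡m δ≤) ,
      m+[n∸m]≡n δ≤ , sym (Boolₚ.not-involutive c)
  ... | rest j with decode-closed m (remaining-admissible i ad) a j
  ...   | j′ , mated = suc (punchIn i j′) , mated′
    where
    mated′ : Mated S (decode (2 + m) S (i , c , v , a)) (suc (punchIn i j)) (suc (punchIn i j′))
    mated′ rewrite decode-remaining ad i c v a j | decode-remaining ad i c v a j′ = mated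

  -- The letter at the first position determines its mate, colour and voltage; induction handles the
  -- remaining points.
  decode-injective : ∀ m {S : Positions m} → Admissible S → (a b : Code m) →
    (∀ j → decode m S a (S j) ≡ decode m S b (S j)) → a ≡ b
  decode-injective zero ad tt tt eq = refl
  decode-injective (suc (suc m)) {S} ad (i , c , v , a) (i′ , c′ , v′ , a′) eq
    with ≡.trans (sym (decode-first ad i c v a)) (≡.trans (eq zero) (decode-first ad i′ c′ v′ a′))
  ... | first≡ with cong colour first≡
      | offset-injective {v = toℕ v} {toℕ v′} (ad .bounded zero) (ad .bounded (suc i)) (ad .bounded (suc i′)) (cong disp first≡)
  ... | refl | Si≡ , v≡ with ad .injective Si≡ | Finₚ.toℕ-injective v≡
  ... | refl | refl = cong (λ b → i , c , v , b) (decode-injective m (remaining-admissible i ad) a a′ λ j →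
    ≡.trans (sym (decode-remaining ad i c v a j)) (≡.trans (eq (suc (punchIn i j))) (decode-remaining ad i c v a′ j)))

  -- The letter at the first position yields the head of the code. Mating is symmetric, so deleting
  -- that chord leaves a closed set of positions, to which induction applies.
  decode-complete : ∀ m {S : Positions m} → Admissible S → ∀ u → Closed S u →
    ∃[ a ] (∀ j → decode m S a (S j) ≡ u (S j))
  decode-complete zero ad u closed = tt , λ ()
  decode-complete (suc zero) ad u closed with closed zero
  ... | zero , _ , _ , col = contradiction col not≢
  decode-complete (suc (suc m)) {S} ad u closed with closed zero
  ... | zero , _ , _ , col = contradiction col not≢
  ... | suc i , target , sum , col = (i , c , v , a) , agrees
    where
    c = colour (u (S zero))
    δ = disp (u (S zero))
    ε = disp (u (S (suc i)))
    -- With `ε = 0` the displacement `δ` would be `k * p` and lead back to the first position. So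
    -- `δ < k * p`, and `δ / p` is a legitimate voltage.
    ε≢0 : ε ≢ 0
    ε≢0 ε≡0 = case ad .injective (≡.trans (sym target) Si≡S0) of λ ()
      where
      Si≡S0 : (S zero + δ) % p ≡ S zero
      Si≡S0 = ≡.trans (cong (λ z → (S zero + z) % p) (≡.trans (cong (_+ δ) (sym ε≡0)) sum))
        (≡.trans ([m+kn]%n≡m%n (S zero) k p) (m<n⇒m%n≡m (ad .bounded zero)))
    δ<kp : δ < k * p
    δ<kp = subst (δ <_) sum (m<n+m δ (n≢0⇒n>0 ε≢0))
    δ/p<k : δ / p < k
    δ/p<k = m<n*o⇒m/o<n δ<kp
    v : Fin k
    v = fromℕ< δ/p<k
    δ≡ : offset (S zero) (S (suc i)) (toℕ v) ≡ δ
    δ≡ = ≡.trans (cong₂ (offset (S zero)) (sym target) (Finₚ.toℕ-fromℕ< δ/p<k)) (offset-cover δ (ad .bounded zero))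
    mate-of-mate : ∀ {j j′} → Mated S u j j′ → (S j′ + disp (u (S j′))) % p ≡ S j
    mate-of-mate {j} (t , s , _) = mate-sym (ad .bounded j) t s
    -- A remaining point mated with `zero` or `suc i` would by symmetry be the mate of that
    -- position, but these two are mates of each other.
    closed′ : Closed (remaining S i) u
    closed′ j with closed (suc (punchIn i j))
    ... | j′ , mated with view i j′
    ... | first = contradiction
      (sym (Finₚ.suc-injective (ad .injective (≡.trans (sym target) (mate-of-mate {suc (punchIn i j)} {zero} mated)))))
      (Finₚ.punchInᵢ≢i i j)
    ... | mate = case ad .injective (≡.trans (sym (mate-of-mate {suc (punchIn i j)} {suc i} mated))
      (mate-of-mate {zero} {suc i} (target , sum , col))) of λ ()
    ... | rest j″ = j″ , mated
    IH = decode-complete m (remaining-admissible i ad) u closed′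
    a = proj₁ IH
    agrees : ∀ j → decode (2 + m) S (i , c , v , a) (S j) ≡ u (S j)
    agrees j with view i j
    ... | first = ≡.trans (decode-first ad i c v a) (cong (_, c) δ≡)
    ... | mate = ≡.trans (decode-mate ad i c v a)
      (cong₂ _,_ (≡.trans (cong (k * p ∸_) δ≡) (sym (≡.trans (sym (m+n∸n≡m ε δ)) (cong (_∸ δ) sum)))) (sym col))
    ... | rest j = ≡.trans (decode-remaining ad i c v a j) (proj₂ IH j)

-- Finite cardinalities in setoids

module _ (S : Setoid 0ℓ 0ℓ) where
  open Setoid S using () renaming (_≈_ to _≋_; sym to ≋-sym)
  open SetoidMembership S renaming (_∈_ to _∈ₛ_)
  open SetoidUnique S renaming (Unique to Uniqueₛ)

  lookup-injective : ∀ {xs} → Uniqueₛ xs → ∀ i j → lookup xs i ≋ lookup xs j → i ≡ j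
  lookup-injective (_ ∷ _) zero zero eq = refl
  lookup-injective (x# ∷ _) zero (suc j) eq = contradiction eq (All.lookup x# (∈-lookup j))
  lookup-injective (x# ∷ _) (suc i) zero eq = contradiction (≋-sym eq) (All.lookup x# (∈-lookup i))
  lookup-injective (_ ∷ u) (suc i) (suc j) eq = cong suc (lookup-injective u i j eq)

  -- Pigeonhole: sending an index of `xs` to the index of an equivalent entry of `ys` is injective,
  -- because equal images make the entries of `xs` equivalent.
  unique⇒length≤ : ∀ {xs ys} → Uniqueₛ xs → (∀ {x} → x ∈ xs → x ∈ₛ ys) → length xs ≤ length ys
  unique⇒length≤ {xs} {ys} u sub = Finₚ.injective⇒≤ {f = λ i → Any.index (sub (∈-lookup i))} λ {i} {j} eq →
    lookup-injective u i j (SetoidMembershipₚ.index-injective S (sub (∈-lookup i)) (sub (∈-lookup j)) eq)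

  unique⇒length≡ : ∀ {xs ys} → Uniqueₛ xs → Uniqueₛ ys →
    (∀ {x} → x ∈ xs → x ∈ₛ ys) → (∀ {x} → x ∈ ys → x ∈ₛ xs) → length xs ≡ length ys
  unique⇒length≡ u v f g = ≤-antisym (unique⇒length≤ u f) (unique⇒length≤ v g)

least : {P : ℕ → Set} → (∀ j → Dec (P j)) → ∀ b → P b → ∃[ m ] (P m × ∀ j → j < m → ¬ P j)
least P? b pb with P? zero
... | yes p₀ = zero , p₀ , λ _ ()
least P? zero pb | no ¬p₀ = contradiction pb ¬p₀
least P? (suc b) pb | no ¬p₀ with least (P? ∘ suc) b pb
... | m , pm , minimal = suc m , pm , λ { zero _ → ¬p₀ ; (suc j) (s≤s j<m) → minimal j j<m }

length-filter-split : {A : Set} {P : A → Set} (P? : ∀ x → Dec (P x)) (xs : List A) →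
  length (filter P? xs) + length (filter (¬? ∘ P?) xs) ≡ length xs
length-filter-split P? [] = refl
length-filter-split P? (x ∷ xs) with P? x
... | yes _ = cong suc (length-filter-split P? xs)
... | no _ = ≡.trans (+-suc _ _) (cong suc (length-filter-split P? xs))

-- Oriented chord diagrams

-- The 2n ends of the chords, read cyclically from a base point; the labels of the loops are forgotten.
record Diagram (n : ℕ) : Set where
  field
    at : ℕ → Letter
    periodic : ∀ x → at (x + 2 * n) ≡ at x
    mate-disp : ∀ x → disp (at (x + disp (at x))) + disp (at x) ≡ 2 * n
    mate-colour : ∀ x → colour (at (x + disp (at x))) ≡ not (colour (at x))
open Diagram

module Diagrams (n : ℕ) .{{n≢0 : NonZero n}} where

  N : ℕ
  N = 2 * n

  instance
    N≢0 : NonZero N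
    N≢0 = m*n≢0 2 n

  N>0 : 0 < N
  N>0 = >-nonZero⁻¹ N

  infix 4 _≈_
  -- Diagrams contain functions and proofs; only the letters are compared, and all counting of
  -- diagrams takes place in this setoid.
  _≈_ : Diagram n → Diagram n → Set
  u ≈ v = ∀ x → at u x ≡ at v x

  diagramSetoid : Setoid 0ℓ 0ℓ
  diagramSetoid = record
    { Carrier = Diagram n ; _≈_ = _≈_
    ; isEquivalence = record { refl = λ _ → refl ; sym = λ e x → sym (e x) ; trans = λ e f x → ≡.trans (e x) (f x) } }

  open SetoidMembership diagramSetoid public using () renaming (_∈_ to _∈ₛ_)
  open SetoidUnique diagramSetoid public using () renaming (Unique to Uniqueₛ)

  -- Periods and the order of a diagram

  Period : ℕ → Diagram n → Set
  Period q u = ∀ x → at u (x + q) ≡ at u x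

  period-* : ∀ {q} r u → Period q u → Period (r * q) u
  period-* zero u per x = cong (at u) (+-identityʳ x)
  period-* {q} (suc r) u per x = ≡.trans (cong (at u) (≡.trans (cong (_+_ x) (+-comm q (r * q))) (sym (+-assoc x (r * q) q))))
    (≡.trans (per (x + r * q)) (period-* r u per x))

  period-∣ : ∀ {p q} u → p ∣ q → Period p u → Period q u
  period-∣ u (divides r refl) = period-* r u

  at-% : ∀ {p} .{{_ : NonZero p}} u → Period p u → ∀ x → at u (x % p) ≡ at u x
  at-% {p} u per x = ≡.trans (sym (period-* (x / p) u per (x % p))) (cong (at u) (sym (m≡m%n+[m/n]*n x p)))

  _≟L_ : (a b : Letter) → Dec (a ≡ b)
  _≟L_ = Productₚ.≡-dec _≟_ Boolₚ._≟_

  fromBounded : ∀ {f g : ℕ → Letter} → (∀ x → f (x % N) ≡ f x) → (∀ x → g (x % N) ≡ g x) →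
    (∀ {x} → x < N → f x ≡ g x) → ∀ x → f x ≡ g x
  fromBounded f% g% eq x = ≡.trans (sym (f% x)) (≡.trans (eq (m%n<n x N)) (g% x))

  _≈?_ : ∀ u v → Dec (u ≈ v)
  u ≈? v with allUpTo? (λ x → at u x ≟L at v x) N
  ... | yes eq = yes (fromBounded (at-% u (periodic u)) (at-% v (periodic v)) eq)
  ... | no ¬eq = no λ u≈v → ¬eq λ {x} _ → u≈v x

  shift : ℕ → Diagram n → Diagram n
  shift a u = record
    { at = λ x → at u (x + a)
    ; periodic = λ x → ≡.trans (cong (at u) (rearrange x N)) (periodic u (x + a))
    ; mate-disp = λ x → ≡.trans (cong (λ y → disp (at u y) + disp (at u (x + a))) (rearrange x (disp (at u (x + a)))))
        (mate-disp u (x + a))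
    ; mate-colour = λ x → ≡.trans (cong (colour ∘ at u) (rearrange x (disp (at u (x + a))))) (mate-colour u (x + a))
    }
    where
    rearrange : ∀ x y → x + y + a ≡ x + a + y
    rearrange x y = ≡.trans (+-assoc x y a) (≡.trans (cong (_+_ x) (+-comm y a)) (sym (+-assoc x a y)))

  period? : ∀ q u → Dec (Period q u)
  period? q u = shift q u ≈? u

  abstract
    minPeriod-spec : ∀ u → ∃[ p ] ((0 < p × Period p u) × ∀ q → q < p → ¬ (0 < q × Period q u))
    minPeriod-spec u = least (λ q → (0 <? q) ×-dec period? q u) N (N>0 , periodic u)

  minPeriod : Diagram n → ℕ
  minPeriod u = proj₁ (minPeriod-spec u)

  minPeriod>0 : ∀ u → 0 < minPeriod u
  minPeriod>0 u = proj₁ (proj₁ (proj₂ (minPeriod-spec u)))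

  minPeriod-period : ∀ u → Period (minPeriod u) u
  minPeriod-period u = proj₂ (proj₁ (proj₂ (minPeriod-spec u)))

  -- Otherwise the remainder `q % p` would be a smaller positive period.
  minPeriod-∣ : ∀ {q} u → Period q u → minPeriod u ∣ q
  minPeriod-∣ {q} u per = m%n≡0⇒n∣m q p (remainder≡0 (q % p ≟ 0))
    where
    p = minPeriod u
    instance
      p≢0 : NonZero p
      p≢0 = >-nonZero (minPeriod>0 u)
    remainder : Period (q % p) u
    remainder x = begin
      at u (x + q % p) ≡⟨ sym (period-* (q / p) u (minPeriod-period u) (x + q % p)) ⟩
      at u (x + q % p + q / p * p) ≡⟨ cong (at u) (≡.trans (+-assoc x _ _) (cong (_+_ x) (sym (m≡m%n+[m/n]*n q p)))) ⟩
      at u (x + q) ≡⟨ per x ⟩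
      at u x ∎
      where open ≡-Reasoning
    remainder≡0 : Dec (q % p ≡ 0) → q % p ≡ 0
    remainder≡0 (yes eq) = eq
    remainder≡0 (no ≢0) = contradiction (n≢0⇒n>0 ≢0 , remainder) (proj₂ (proj₂ (minPeriod-spec u)) (q % p) (m%n<n q p))

  period-resp : ∀ {q u v} → u ≈ v → Period q u → Period q v
  period-resp u≈v per x = ≡.trans (sym (u≈v _)) (≡.trans (per x) (u≈v x))

  minPeriod-cong : ∀ {u v} → u ≈ v → minPeriod u ≡ minPeriod v
  minPeriod-cong {u} {v} u≈v = ∣-antisym
    (minPeriod-∣ u (period-resp {u = v} {u} (λ x → sym (u≈v x)) (minPeriod-period v)))
    (minPeriod-∣ v (period-resp {u = u} {v} u≈v (minPeriod-period u)))

  abstract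
    -- The number of minimal periods around the circle. `symmetry` shows that it is the order of the
    -- automorphism group of a map with this diagram.
    order : Diagram n → ℕ
    order u = quotient (minPeriod-∣ u (periodic u))

    order*minPeriod : ∀ u → order u * minPeriod u ≡ N
    order*minPeriod u = sym (m∣n⇒n≡quotient*m (minPeriod-∣ u (periodic u)))

  order-cong : ∀ {u v} → u ≈ v → order u ≡ order v
  order-cong {u} {v} u≈v = *-cancelʳ-≡ (order u) (order v) (minPeriod u) {{>-nonZero (minPeriod>0 u)}}
    (≡.trans (order*minPeriod u) (≡.trans (sym (order*minPeriod v)) (cong (order v *_) (sym (minPeriod-cong {u} {v} u≈v)))))

  -- Diagrams with a given period

  module OfPeriod (p k : ℕ) .{{_ : NonZero p}} (kp≡N : k * p ≡ N) where
    open Decoding p k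

    positions : Positions p
    positions = toℕ

    admissible : Admissible positions
    admissible = record { bounded = Finₚ.toℕ<n ; injective = Finₚ.toℕ-injective }

    residue : ℕ → Fin p
    residue x = fromℕ< (m%n<n x p)

    toℕ-residue : ∀ x → toℕ (residue x) ≡ x % p
    toℕ-residue x = Finₚ.toℕ-fromℕ< (m%n<n x p)

    word : Code p → ℕ → Letter
    word a x = decode p positions a (x % p)

    word-mated : ∀ a x →
      disp (word a (x + disp (word a x))) + disp (word a x) ≡ k * p ×
      colour (word a (x + disp (word a x))) ≡ not (colour (word a x))
    word-mated a x with decode-closed p admissible a (residue x)
    ... | j′ , target , mated rewrite sym target | toℕ-residue x =
      subst (λ y → disp (decode p positions a y) + disp (word a x) ≡ k * p × colour (decode p positions a y) ≡ not (colour (word a x)))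
        (%-absorbˡ x (disp (word a x)) p) mated

    fromCode : Code p → Diagram n
    fromCode a = record
      { at = word a
      ; periodic = λ x → cong (decode p positions a) (≡.trans (cong (λ z → (x + z) % p) (sym kp≡N)) ([m+kn]%n≡m%n x k p))
      ; mate-disp = λ x → ≡.trans (proj₁ (word-mated a x)) kp≡N
      ; mate-colour = λ x → proj₂ (word-mated a x)
      }

    fromCode-period : ∀ a → Period p (fromCode a)
    fromCode-period a x = cong (decode p positions a) ([m+n]%n≡m%n x p)

    fromCode-injective : ∀ {a b} → fromCode a ≈ fromCode b → a ≡ b
    fromCode-injective {a} {b} eq = decode-injective p admissible a b λ j →
      subst (λ x → decode p positions a x ≡ decode p positions b x) (m<n⇒m%n≡m (Finₚ.toℕ<n j)) (eq (toℕ j))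

    -- A word of period `p` is known from its letters at the residues, and these are closed under
    -- mating because targets matter only modulo `p`.
    fromCode-complete : ∀ u → Period p u → ∃[ a ] (u ≈ fromCode a)
    fromCode-complete u per = a , λ x → begin
      at u x ≡⟨ sym (at-% u per x) ⟩
      at u (x % p) ≡⟨ cong (at u) (sym (toℕ-residue x)) ⟩
      at u (positions (residue x)) ≡⟨ sym (agrees (residue x)) ⟩
      decode p positions a (positions (residue x)) ≡⟨ cong (decode p positions a) (toℕ-residue x) ⟩
      word a x ∎
      where
      open ≡-Reasoning
      closed : Closed positions (at u)
      closed j = residue (toℕ j + disp (at u (toℕ j))) , sym (toℕ-residue _) ,
        ≡.trans (cong (λ a → disp a + disp (at u (toℕ j))) at-mate) (≡.trans (mate-disp u (toℕ j)) (sym kp≡N)) ,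
        ≡.trans (cong colour at-mate) (mate-colour u (toℕ j))
        where
        at-mate : at u (toℕ (residue (toℕ j + disp (at u (toℕ j))))) ≡ at u (toℕ j + disp (at u (toℕ j)))
        at-mate = ≡.trans (cong (at u) (toℕ-residue _)) (at-% u per _)
      completion = decode-complete p admissible (at u) closed
      a = proj₁ completion
      agrees = proj₂ completion

    diagrams : List (Diagram n)
    diagrams = map fromCode (allCodes p)

    diagrams-unique : Uniqueₛ diagrams
    diagrams-unique = SetoidUniqueₚ.map⁺ (≡.setoid _) diagramSetoid fromCode-injective (allCodes-unique p)

    diagrams-complete : ∀ u → Period p u → u ∈ₛ diagrams
    diagrams-complete u per = let a , u≈a = fromCode-complete u per in
      Any.map (λ { refl → u≈a }) (∈-map⁺ fromCode (∈-allCodes p a))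

    diagrams-period : ∀ {u} → u ∈ diagrams → Period p u
    diagrams-period u∈ with ∈-map⁻ fromCode u∈
    ... | a , _ , refl = fromCode-period a

    length-diagrams : length diagrams ≡ length (allCodes p)
    length-diagrams = Listₚ.length-map fromCode (allCodes p)

    period-even : ∀ u → Period p u → 2 ∣ p
    period-even u per = Code⇒even p (proj₁ (fromCode-complete u per))

  -- The minimal period is even, since the chords pair off the points within one period; so
  -- `order u * minPeriod u = 2 * n` can be halved.
  order-∣ : ∀ u → order u ∣ n
  order-∣ u with OfPeriod.period-even (minPeriod u) (order u) {{>-nonZero (minPeriod>0 u)}} (order*minPeriod u) u (minPeriod-period u)
  ... | divides q p≡q*2 = divides q (*-cancelʳ-≡ n (q * order u) 2 (begin
    n * 2 ≡⟨ *-comm n 2 ⟩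
    N ≡⟨ sym (order*minPeriod u) ⟩
    order u * minPeriod u ≡⟨ cong (order u *_) p≡q*2 ⟩
    order u * (q * 2) ≡⟨ sym (*-assoc (order u) q 2) ⟩
    order u * q * 2 ≡⟨ cong (_* 2) (*-comm (order u) q) ⟩
    q * order u * 2 ∎))
    where open ≡-Reasoning

  -- The periods are the multiples of the minimal one. As `k * c = order u * minPeriod u`, `c` is
  -- such a multiple exactly when `k` divides `order u`.
  order-∣⇔period : ∀ {k c} .{{_ : NonZero k}} u → k * c ≡ N → (k ∣ order u → Period c u) × (Period c u → k ∣ order u)
  order-∣⇔period {k} {c} u kc≡N = to , from
    where
    p = minPeriod u
    to : k ∣ order u → Period c u
    to (divides r eq) = period-∣ u (divides r (*-cancelˡ-≡ c (r * p) k (begin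
      k * c ≡⟨ kc≡N ⟩
      N ≡⟨ sym (order*minPeriod u) ⟩
      order u * p ≡⟨ cong (_* p) (≡.trans eq (*-comm r k)) ⟩
      k * r * p ≡⟨ *-assoc k r p ⟩
      k * (r * p) ∎))) (minPeriod-period u)
      where open ≡-Reasoning
    from : Period c u → k ∣ order u
    from per with minPeriod-∣ u per
    ... | divides r refl = divides r (*-cancelʳ-≡ (order u) (r * k) p {{>-nonZero (minPeriod>0 u)}} (begin
      order u * p ≡⟨ order*minPeriod u ⟩
      N ≡⟨ sym kc≡N ⟩
      k * (r * p) ≡⟨ sym (*-assoc k r p) ⟩
      k * r * p ≡⟨ cong (_* p) (*-comm k r) ⟩
      r * k * p ∎))
      where open ≡-Reasoning

  -- Counting diagrams by order

  open OfPeriod N 1 (*-identityˡ N) public using () renaming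
    (diagrams to allDiagrams; diagrams-unique to allDiagrams-unique)

  -- Every diagram has period `N`, so the codes on `N` points with the single voltage of `k = 1`
  -- list them all.
  ∈ₛ-allDiagrams : ∀ u → u ∈ₛ allDiagrams
  ∈ₛ-allDiagrams u = OfPeriod.diagrams-complete N 1 (*-identityˡ N) u (periodic u)

  ∈ₛ-filter : ∀ {P : Diagram n → Set} (P? : ∀ u → Dec (P u)) → (∀ {u v} → u ≈ v → P u → P v) →
    ∀ {u} → P u → u ∈ₛ filter P? allDiagrams
  ∈ₛ-filter P? resp {u} Pu = SetoidMembershipₚ.∈-filter⁺ diagramSetoid P? (λ {u} {v} → resp {u} {v}) (∈ₛ-allDiagrams u) Pu

  filter-unique : ∀ {P : Diagram n → Set} (P? : ∀ u → Dec (P u)) → Uniqueₛ (filter P? allDiagrams)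
  filter-unique P? = SetoidUniqueₚ.filter⁺ diagramSetoid P? allDiagrams-unique

  count-order-∣ : ∀ {k} → k ∣ n →
    length (filter (λ u → k ∣? order u) allDiagrams) ≡ (((2 * n) ÷ k) ! * k ^ (n ÷ k)) ÷ ((n ÷ k) !)
  count-order-∣ {k} k∣n@(divides m eq) = begin
    length (filter (λ u → k ∣? order u) allDiagrams)
      ≡⟨ unique⇒length≡ diagramSetoid (filter-unique (λ u → k ∣? order u)) diagrams-unique
        (λ {u} u∈ → diagrams-complete u (proj₁ (order-∣⇔period u k2m≡N)
          (proj₂ (∈-filter⁻ (λ u → k ∣? order u) {xs = allDiagrams} u∈))))
        (λ {u} u∈ → ∈ₛ-filter (λ u → k ∣? order u) (λ {u} {v} u≈v → subst (k ∣_) (order-cong {u} {v} u≈v))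
          (proj₂ (order-∣⇔period u k2m≡N) (diagrams-period u∈))) ⟩
    length diagrams ≡⟨ length-diagrams ⟩
    -- Multiplying and dividing by `m !` brings in the truncating `÷` of the statement where it is
    -- exact.
    length (allCodes (2 * m)) ≡⟨ sym (m*n÷m≡n (m !) (length (allCodes (2 * m)))) ⟩
    ((m !) * length (allCodes (2 * m))) ÷ (m !) ≡⟨ cong (_÷ (m !)) (length-allCodes m) ⟩
    (((2 * m) !) * k ^ m) ÷ (m !) ≡⟨ cong₂ (λ a b → ((a !) * k ^ b) ÷ (b !)) (sym N÷k≡2m) (sym n÷k≡m) ⟩
    (((2 * n) ÷ k) ! * k ^ (n ÷ k)) ÷ ((n ÷ k) !) ∎
    where
    open ≡-Reasoning
    instance
      k≢0 : NonZero k
      k≢0 = ∣-nonZero k∣n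
      m≢0 : NonZero m
      m≢0 = ∣-nonZero (subst (m ∣_) (sym eq) (m∣m*n k))
      2m≢0 : NonZero (2 * m)
      2m≢0 = m*n≢0 2 m
      m!≢0 : NonZero (m !)
      m!≢0 = m !≢0
    k2m≡N : k * (2 * m) ≡ N
    k2m≡N = ≡.trans (*-comm k (2 * m)) (≡.trans (*-assoc 2 m k) (cong (2 *_) (sym eq)))
    N÷k≡2m : N ÷ k ≡ 2 * m
    N÷k≡2m = ≡.trans (cong (_÷ k) (sym k2m≡N)) (m*n÷m≡n k (2 * m))
    n÷k≡m : n ÷ k ≡ m
    n÷k≡m = ≡.trans (cong (_÷ k) (≡.trans eq (*-comm m k))) (m*n÷m≡n k m)
    open OfPeriod (2 * m) k k2m≡N
    open Decoding (2 * m) k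

  ofOrder : ℕ → List (Diagram n)
  ofOrder d = filter (λ u → order u ≟ d) allDiagrams

  -- The indicator of `order u = d` is expanded by Möbius inversion, available because
  -- `order u ∣ n`; exchanging the two sums leaves the counts of diagrams whose order is a multiple
  -- of `k`.
  length-ofOrder : ∀ {d} → d ∣ n → + length (ofOrder d) ≡ formulaSum n d
  length-ofOrder {d} d∣n = begin
    + length (ofOrder d)
      ≡⟨ sym (Σℤ-indicator (λ u → order u ≟ d) allDiagrams) ⟩
    Σℤ (λ u → indicator (order u ≟ d)) allDiagrams
      ≡⟨ Σℤ-cong allDiagrams (λ {u} _ → sym (möbius-inversion d∣n (order-∣ u))) ⟩
    Σℤ (λ u → Σℤ (λ k → μ (k ÷ d) ℤ.* indicator (k ∣? order u)) (intervalDivisors d n)) allDiagrams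
      ≡⟨ Σℤ-swap (λ u k → μ (k ÷ d) ℤ.* indicator (k ∣? order u)) allDiagrams (intervalDivisors d n) ⟩
    Σℤ (λ k → Σℤ (λ u → μ (k ÷ d) ℤ.* indicator (k ∣? order u)) allDiagrams) (intervalDivisors d n)
      ≡⟨ Σℤ-cong (intervalDivisors d n) (λ {k} k∈ → ≡.trans
          (Σℤ-* (μ (k ÷ d)) (λ u → indicator (k ∣? order u)) allDiagrams)
          (cong (μ (k ÷ d) ℤ.*_) (≡.trans (Σℤ-indicator (λ u → k ∣? order u) allDiagrams)
            (cong +_ (count-order-∣ (proj₂ (∈-intervalDivisors⁻ {d} {n} k∈))))))) ⟩
    formulaSum n d ∎
    where open ≡-Reasoning

  -- Rotation classes

  infix 4 _⟳_
  _⟳_ : Diagram n → Diagram n → Set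
  u ⟳ v = ∃[ a ] (shift a u ≈ v)

  ⟳-respʳ : ∀ {u v w} → v ≈ w → u ⟳ v → u ⟳ w
  ⟳-respʳ v≈w (a , e) = a , λ x → ≡.trans (e x) (v≈w x)

  ⟳-trans : ∀ {u v w} → u ⟳ v → v ⟳ w → u ⟳ w
  ⟳-trans {u} (a , e) (b , f) = b + a , λ x → ≡.trans (cong (at u) (sym (+-assoc x b a))) (≡.trans (e (x + b)) (f x))

  -- The inverse of the shift by a is the shift by a (N − 1).
  inverseShift : ℕ → ℕ
  inverseShift a = a * (N ∸ 1)

  inverseShift-+ : ∀ a → inverseShift a + a ≡ a * N
  inverseShift-+ a = begin
    a * (N ∸ 1) + a ≡⟨ +-comm _ a ⟩
    a + a * (N ∸ 1) ≡⟨ sym (*-suc a (N ∸ 1)) ⟩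
    a * suc (N ∸ 1) ≡⟨ cong (a *_) (m+[n∸m]≡n N>0) ⟩
    a * N ∎
    where open ≡-Reasoning

  shift-inverse : ∀ u a x → at u (x + inverseShift a + a) ≡ at u x
  shift-inverse u a x = ≡.trans (cong (at u) (≡.trans (+-assoc x _ a) (cong (_+_ x) (inverseShift-+ a)))) (period-* a u (periodic u) x)

  ⟳-sym : ∀ {u v} → u ⟳ v → v ⟳ u
  ⟳-sym {u} (a , e) = inverseShift a , λ x → ≡.trans (sym (e (x + inverseShift a))) (shift-inverse u a x)

  shift-% : ∀ {p} .{{_ : NonZero p}} u a → Period p u → shift (a % p) u ≈ shift a u
  shift-% {p} u a per x = ≡.trans (sym (period-* (a / p) u per (x + a % p)))
    (cong (at u) (≡.trans (+-assoc x _ _) (cong (_+_ x) (sym (m≡m%n+[m/n]*n a p)))))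

  _⟳?_ : ∀ u v → Dec (u ⟳ v)
  u ⟳? v with anyUpTo? (λ a → shift a u ≈? v) N
  ... | yes (a , _ , e) = yes (a , e)
  ... | no ¬e = no λ { (a , e) → ¬e (a % N , m%n<n a N , λ x → ≡.trans (shift-% u a (periodic u) x) (e x)) }

  rotations : Diagram n → List (Diagram n)
  rotations u = map (λ a → shift a u) (upTo (minPeriod u))

  shift-≈⇒period : ∀ u a c → shift a u ≈ shift (c + a) u → Period c u
  shift-≈⇒period u a c eq x = begin
    at u (x + c) ≡⟨ sym (shift-inverse u a (x + c)) ⟩
    at u (x + c + b + a) ≡⟨ cong (at u) rearrange ⟩
    at u (x + b + (c + a)) ≡⟨ sym (eq (x + b)) ⟩
    at u (x + b + a) ≡⟨ shift-inverse u a x ⟩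
    at u x ∎
    where
    open ≡-Reasoning
    b = inverseShift a
    rearrange : x + c + b + a ≡ x + b + (c + a)
    rearrange = solve 4 (λ x c b a → x :+ c :+ b :+ a := x :+ b :+ (c :+ a)) refl x c b a
      where open Data.Nat.Solver.+-*-Solver

  -- Equal shifts by `i < j` would make `j ∸ i` a positive period below the least one.
  rotations-unique : ∀ u → Uniqueₛ (rotations u)
  rotations-unique u = subst Uniqueₛ (sym (Listₚ.map-upTo (λ a → shift a u) (minPeriod u)))
    (SetoidUniqueₚ.applyUpTo⁺₁ diagramSetoid (λ a → shift a u) (minPeriod u) distinct)
    where
    distinct : ∀ {i j} → i < j → j < minPeriod u → ¬ (shift i u ≈ shift j u)
    distinct {i} {j} i<j j<p eq = >⇒∤ {{>-nonZero (m<n⇒0<n∸m i<j)}} (≤-<-trans (m∸n≤m j i) j<p)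
      (minPeriod-∣ u (shift-≈⇒period u i (j ∸ i) (subst (λ j → shift i u ≈ shift j u) (sym (m∸n+n≡m (<⇒≤ i<j))) eq)))

  length-rotations : ∀ u → length (rotations u) ≡ minPeriod u
  length-rotations u = ≡.trans (Listₚ.length-map _ (upTo (minPeriod u))) (Listₚ.length-upTo (minPeriod u))

  ∈ₛ-rotations : ∀ {u v} → u ⟳ v → v ∈ₛ rotations u
  ∈ₛ-rotations {u} {v} (a , e) = Any.map (λ { refl x → ≡.trans (sym (e x)) (sym (shift-% u a (minPeriod-period u) x)) })
    (∈-map⁺ (λ a → shift a u) (∈-upTo⁺ (m%n<n a (minPeriod u))))
    where
    instance
      p≢0 : NonZero (minPeriod u)
      p≢0 = >-nonZero (minPeriod>0 u)

  rotations-⟳ : ∀ {u v} → v ∈ rotations u → u ⟳ v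
  rotations-⟳ {u} v∈ with ∈-map⁻ (λ a → shift a u) v∈
  ... | a , _ , refl = a , λ _ → refl

  record Transversal (p : ℕ) (us : List (Diagram n)) : Set where
    field
      reps : List (Diagram n)
      reps⊆ : ∀ {r} → r ∈ reps → r ∈ us
      covers : ∀ {u} → u ∈ us → Any (_⟳ u) reps
      irredundant : AllPairs (λ r s → ¬ (r ⟳ s)) reps
      count : p * length reps ≡ length us

  -- Rotation classes are peeled off one at a time: the class of the head has exactly `p` members,
  -- and the rest is still closed under rotation. `f` is fuel, since `others` is no structural part
  -- of `us`.
  transversal : ∀ p f us → length us ≤ f → Uniqueₛ us →
    (∀ {u} → u ∈ us → minPeriod u ≡ p) → (∀ {u} a → u ∈ us → shift a u ∈ₛ us) → Transversal p us
  transversal p f [] _ _ _ _ = record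
    { reps = [] ; reps⊆ = λ () ; covers = λ () ; irredundant = [] ; count = *-zeroʳ p }
  transversal p (suc f) us@(u ∷ _) len≤ unique minimal closed = record
    { reps = u ∷ reps
    ; reps⊆ = λ { (here refl) → here refl ; (there r∈) → proj₁ (others⁻ (reps⊆ r∈)) }
    ; covers = covers′
    ; irredundant = All.tabulate (λ r∈ → proj₂ (others⁻ (reps⊆ r∈))) ∷ irredundant
    ; count = begin
        p * suc (length reps) ≡⟨ *-suc p (length reps) ⟩
        p + p * length reps ≡⟨ cong₂ _+_ (sym length-orbit) count ⟩
        length orbit + length others ≡⟨ length-filter-split (u ⟳?_) us ⟩
        length us ∎
    }
    where
    open ≡-Reasoning
    orbit = filter (u ⟳?_) us
    others = filter (¬? ∘ (u ⟳?_)) us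
    others⁻ : ∀ {v} → v ∈ others → v ∈ us × ¬ (u ⟳ v)
    others⁻ = ∈-filter⁻ (¬? ∘ (u ⟳?_)) {xs = us}
    length-orbit : length orbit ≡ p
    length-orbit = ≡.trans
      (unique⇒length≡ diagramSetoid (SetoidUniqueₚ.filter⁺ diagramSetoid (u ⟳?_) unique) (rotations-unique u)
        (λ {v} v∈ → ∈ₛ-rotations {u} {v} (proj₂ (∈-filter⁻ (u ⟳?_) {xs = us} v∈)))
        (λ {v} v∈ → let a , e = rotations-⟳ {u} {v} v∈ in
          SetoidMembershipₚ.∈-filter⁺ diagramSetoid (u ⟳?_) (λ {v} {w} → ⟳-respʳ {u} {v} {w}) {v = v}
            (SetoidMembershipₚ.∈-resp-≈ diagramSetoid {us} {shift a u} {v} e (closed a (here refl))) (a , e)))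
      (≡.trans (length-rotations u) (minimal (here refl)))
    -- The class of `u` has `minPeriod u > 0` members, so removing it shortens the list.
    others≤ : length others ≤ f
    others≤ = ≤-pred (≤-trans (subst (length others <_) (length-filter-split (u ⟳?_) us)
      (m<n+m (length others) (subst (0 <_) (≡.trans (minimal (here refl)) (sym length-orbit)) (minPeriod>0 u)))) len≤)
    others-transversal : Transversal p others
    others-transversal = transversal p f others others≤ (SetoidUniqueₚ.filter⁺ diagramSetoid (¬? ∘ (u ⟳?_)) unique)
      (λ v∈ → minimal (proj₁ (others⁻ v∈)))
      (λ {v} a v∈ → let v∈us , ¬u⟳v = others⁻ v∈ in
        SetoidMembershipₚ.∈-filter⁺ diagramSetoid (¬? ∘ (u ⟳?_))
          (λ {v} {w} v≈w ¬u⟳v → ¬u⟳v ∘ ⟳-respʳ {u} {w} {v} (λ x → sym (v≈w x))) {v = shift a v}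
          (closed a v∈us) (λ u⟳av → ¬u⟳v (⟳-trans {u} {shift a v} {v} u⟳av (⟳-sym {v} {shift a v} (a , λ _ → refl)))))
    open Transversal others-transversal
    covers′ : ∀ {v} → v ∈ us → Any (_⟳ v) (u ∷ reps)
    covers′ {v} v∈ = decide (u ⟳? v)
      where
      decide : Dec (u ⟳ v) → Any (_⟳ v) (u ∷ reps)
      decide (yes u⟳v) = here u⟳v
      decide (no ¬u⟳v) = there (covers (∈-filter⁺ (¬? ∘ (u ⟳?_)) v∈ ¬u⟳v))

  period-shift : ∀ {q} a u → Period q u → Period q (shift a u)
  period-shift {q} a u per x = ≡.trans (cong (at u) rearrange) (per (x + a))
    where
    rearrange : x + q + a ≡ x + a + q
    rearrange = ≡.trans (+-assoc x q a) (≡.trans (cong (_+_ x) (+-comm q a)) (sym (+-assoc x a q)))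

  period-⟳ : ∀ {q u v} → u ⟳ v → Period q u → Period q v
  period-⟳ {q} {u} {v} (a , e) per = period-resp {q} {shift a u} {v} e (period-shift a u per)

  order-⟳ : ∀ {u v} → u ⟳ v → order u ≡ order v
  order-⟳ {u} {v} u⟳v = *-cancelʳ-≡ (order u) (order v) (minPeriod u) {{>-nonZero (minPeriod>0 u)}}
    (≡.trans (order*minPeriod u) (≡.trans (sym (order*minPeriod v)) (cong (order v *_) (sym same))))
    where
    same : minPeriod u ≡ minPeriod v
    same = ∣-antisym
      (minPeriod-∣ u (period-⟳ {u = v} {u} (⟳-sym {u} {v} u⟳v) (minPeriod-period v)))
      (minPeriod-∣ v (period-⟳ {u = u} {v} u⟳v (minPeriod-period u)))

  transversal-ofOrder : ∀ {d c} .{{_ : NonZero d}} → d * c ≡ N → Transversal c (ofOrder d)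
  transversal-ofOrder {d} {c} dc≡N = transversal c (length (ofOrder d)) (ofOrder d) ≤-refl (filter-unique (λ u → order u ≟ d))
    (λ {u} u∈ → *-cancelˡ-≡ (minPeriod u) c d (≡.trans (cong (_* minPeriod u) (sym (order≡ u∈)))
      (≡.trans (order*minPeriod u) (sym dc≡N))))
    (λ {u} a u∈ → ∈ₛ-filter (λ u → order u ≟ d) (λ {u} {v} u≈v → ≡.trans (sym (order-cong {u} {v} u≈v))) {shift a u}
      (≡.trans (sym (order-⟳ {u} {shift a u} (a , λ _ → refl))) (order≡ u∈)))
    where
    order≡ : ∀ {u} → u ∈ ofOrder d → order u ≡ d
    order≡ u∈ = proj₂ (∈-filter⁻ (λ u → order u ≟ d) {xs = allDiagrams} u∈)

-- Iterates of a function

module _ {A : Set} (f : A → A) where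

  ^[]-+ : ∀ a b x → (f ^[ a + b ]) x ≡ (f ^[ a ]) ((f ^[ b ]) x)
  ^[]-+ zero b x = refl
  ^[]-+ (suc a) b x = cong f (^[]-+ a b x)

  ^[]-comm : ∀ a b x → (f ^[ a ]) ((f ^[ b ]) x) ≡ (f ^[ b ]) ((f ^[ a ]) x)
  ^[]-comm a b x = ≡.trans (sym (^[]-+ a b x)) (≡.trans (cong (λ k → (f ^[ k ]) x) (+-comm a b)) (^[]-+ b a x))

  ^[]-* : ∀ a b x → (f ^[ a * b ]) x ≡ ((f ^[ b ]) ^[ a ]) x
  ^[]-* zero b x = refl
  ^[]-* (suc a) b x = ≡.trans (^[]-+ b (a * b) x) (cong (f ^[ b ]) (^[]-* a b x))

  ^[]-fixed : ∀ a x → f x ≡ x → (f ^[ a ]) x ≡ x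
  ^[]-fixed zero x fx≡x = refl
  ^[]-fixed (suc a) x fx≡x = ≡.trans (cong f (^[]-fixed a x fx≡x)) fx≡x

  ^[]-injective : (∀ {x y} → f x ≡ f y → x ≡ y) → ∀ a {x y} → (f ^[ a ]) x ≡ (f ^[ a ]) y → x ≡ y
  ^[]-injective inj zero eq = eq
  ^[]-injective inj (suc a) eq = ^[]-injective inj a (inj eq)

^[]-cong : ∀ {A : Set} {f g : A → A} → (∀ x → f x ≡ g x) → ∀ a x → (f ^[ a ]) x ≡ (g ^[ a ]) x
^[]-cong eq zero x = refl
^[]-cong {f = f} {g} eq (suc a) x = ≡.trans (cong f (^[]-cong eq a x)) (eq ((g ^[ a ]) x))

^[]-natural : ∀ {A B : Set} {f : A → A} {g : B → B} (h : A → B) → (∀ x → h (f x) ≡ g (h x)) →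
  ∀ a x → h ((f ^[ a ]) x) ≡ (g ^[ a ]) (h x)
^[]-natural h eq zero x = refl
^[]-natural {f = f} {g} h eq (suc a) x = ≡.trans (eq ((f ^[ a ]) x)) (cong g (^[]-natural h eq a x))

-- The ends of the loops

module _ {n : ℕ} where

  partner : NC n → NC n
  partner (inj₁ i) = inj₂ i
  partner (inj₂ i) = inj₁ i

  kind : NC n → Bool
  kind (inj₁ _) = false
  kind (inj₂ _) = true

  loop : NC n → Fin n
  loop (inj₁ i) = i
  loop (inj₂ i) = i

  partner-involutive : ∀ y → partner (partner y) ≡ y
  partner-involutive (inj₁ i) = refl
  partner-involutive (inj₂ i) = refl

  kind-partner : ∀ y → kind (partner y) ≡ not (kind y)
  kind-partner (inj₁ i) = refl
  kind-partner (inj₂ i) = refl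

  partner≢ : ∀ y → partner y ≢ y
  partner≢ (inj₁ i) ()
  partner≢ (inj₂ i) ()

  black : ∀ y → kind y ≡ false → y ≡ inj₁ (loop y)
  black (inj₁ i) _ = refl

  inj₁-injective : ∀ {i j : Fin n} → _≡_ {A = NC n} (inj₁ i) (inj₁ j) → i ≡ j
  inj₁-injective refl = refl

  ends : List (NC n)
  ends = map inj₁ (allFin n) ++ map inj₂ (allFin n)

  ends-unique : Unique ends
  ends-unique = Uniqueₚ.++⁺ (Uniqueₚ.map⁺ (λ { refl → refl }) (Uniqueₚ.allFin⁺ n))
    (Uniqueₚ.map⁺ (λ { refl → refl }) (Uniqueₚ.allFin⁺ n)) disjoint
    where
    disjoint : ∀ {y} → y ∈ map inj₁ (allFin n) × y ∈ map inj₂ (allFin n) → ⊥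
    disjoint (p , q) with ∈-map⁻ inj₁ p | ∈-map⁻ inj₂ q
    ... | _ , _ , refl | _ , _ , ()

  ∈-ends : ∀ y → y ∈ ends
  ∈-ends (inj₁ i) = ∈-++⁺ˡ (∈-map⁺ inj₁ (∈-allFin i))
  ∈-ends (inj₂ i) = ∈-++⁺ʳ (map inj₁ (allFin n)) (∈-map⁺ inj₂ (∈-allFin i))

  length-ends : length ends ≡ 2 * n
  length-ends = begin
    length ends ≡⟨ Listₚ.length-++ (map inj₁ (allFin n)) ⟩
    length (map inj₁ (allFin n)) + length (map inj₂ (allFin n))
      ≡⟨ cong₂ _+_ (≡.trans (Listₚ.length-map inj₁ (allFin n)) allFin-n) (≡.trans (Listₚ.length-map inj₂ (allFin n)) allFin-n) ⟩
    n + n ≡⟨ cong (_+_ n) (sym (+-identityʳ n)) ⟩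
    2 * n ∎
    where
    open ≡-Reasoning
    allFin-n : length (allFin n) ≡ n
    allFin-n = Listₚ.length-tabulate {n = n} id

  lift-∘ : ∀ (f g : Fin n → Fin n) y → lift f (lift g y) ≡ lift (f ∘ g) y
  lift-∘ f g (inj₁ i) = refl
  lift-∘ f g (inj₂ i) = refl

  lift-id : ∀ {f : Fin n → Fin n} → (∀ i → f i ≡ i) → ∀ y → lift f y ≡ y
  lift-id eq (inj₁ i) = cong inj₁ (eq i)
  lift-id eq (inj₂ i) = cong inj₂ (eq i)

  lift-cong : ∀ {f g : Fin n → Fin n} → (∀ i → f i ≡ g i) → ∀ y → lift f y ≡ lift g y
  lift-cong eq (inj₁ i) = cong inj₁ (eq i)
  lift-cong eq (inj₂ i) = cong inj₂ (eq i)

  lift-^[] : ∀ (f : Fin n → Fin n) j y → lift (f ^[ j ]) y ≡ (lift f ^[ j ]) y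
  lift-^[] f zero y = lift-id (λ _ → refl) y
  lift-^[] f (suc j) y = ≡.trans (sym (lift-∘ f (f ^[ j ]) y)) (cong (lift f) (lift-^[] f j y))

  partner-lift : ∀ (f : Fin n → Fin n) y → lift f (partner y) ≡ partner (lift f y)
  partner-lift f (inj₁ i) = refl
  partner-lift f (inj₂ i) = refl

  kind-lift : ∀ (f : Fin n → Fin n) y → kind (lift f y) ≡ kind y
  kind-lift f (inj₁ i) = refl
  kind-lift f (inj₂ i) = refl

-- From maps to diagrams

module MapDiagrams (n : ℕ) .{{n≢0 : NonZero n}} where
  open Diagrams n

  step : Map n → NC n → NC n
  step M = Inverse.to (rot M)

  turn : Map n → ℕ → NC n → NC n
  turn M k = step M ^[ k ]

  step-injective : ∀ M {x y} → step M x ≡ step M y → x ≡ y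
  step-injective M eq = ≡.trans (sym (Inverse.strictlyInverseʳ (rot M) _))
    (≡.trans (cong (Inverse.from (rot M)) eq) (Inverse.strictlyInverseʳ (rot M) _))

  _≟NC_ : (x y : NC n) → Dec (x ≡ y)
  _≟NC_ = Sumₚ.≡-dec Finₚ._≟_ Finₚ._≟_

  turn-multiple : ∀ M {m z} → turn M m z ≡ z → ∀ r → turn M (r * m) z ≡ z
  turn-multiple M {m} {z} fixed r = ≡.trans (^[]-* (step M) r m z) (^[]-fixed (turn M m) r z fixed)

  turn-mod : ∀ M {m z} .{{_ : NonZero m}} → turn M m z ≡ z → ∀ k → turn M (k % m) z ≡ turn M k z
  turn-mod M {m} {z} fixed k = begin
    turn M (k % m) z ≡⟨ cong (turn M (k % m)) (sym (turn-multiple M fixed (k / m))) ⟩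
    turn M (k % m) (turn M (k / m * m) z) ≡⟨ sym (^[]-+ (step M) (k % m) (k / m * m) z) ⟩
    turn M (k % m + k / m * m) z ≡⟨ cong (λ k → turn M k z) (sym (m≡m%n+[m/n]*n k m)) ⟩
    turn M k z ∎
    where open ≡-Reasoning

  turn-suc : ∀ M k z → turn M k (step M z) ≡ turn M (suc k) z
  turn-suc M k z = ^[]-comm (step M) k 1 z

  firstReturn : ∀ M z → ∃[ m ] ((0 < m × turn M m z ≡ z) × (∀ j → j < m → ¬ (0 < j × turn M j z ≡ z)))
  -- Travelling to `z` from `step M z` gives the positive return time `suc k`; `single M z z` could
  -- answer 0.
  firstReturn M z = let k , eq = single M (step M z) z in
    least (λ j → (0 <? j) ×-dec (turn M j z ≟NC z)) (suc k) (s≤s z≤n , ≡.trans (sym (turn-suc M k z)) eq)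

  -- The ends met before the first return are distinct, and the single cycle reaches all `2 * n`
  -- ends.
  cycle-length : ∀ M z m → 0 < m → turn M m z ≡ z → (∀ j → j < m → ¬ (0 < j × turn M j z ≡ z)) → m ≡ N
  cycle-length M z m 0<m fixed minimal = begin
    m ≡⟨ sym (Listₚ.length-applyUpTo orbit m) ⟩
    length (applyUpTo orbit m)
      ≡⟨ unique⇒length≡ (≡.setoid (NC n)) (Uniqueₚ.applyUpTo⁺₁ orbit m distinct) ends-unique
          (λ {y} _ → ∈-ends y) (λ {y} _ → reached y) ⟩
    length (ends {n}) ≡⟨ length-ends {n} ⟩
    N ∎
    where
    open ≡-Reasoning
    instance
      m≢0 : NonZero m
      m≢0 = >-nonZero 0<m
    orbit : ℕ → NC n
    orbit k = turn M k z
    distinct : ∀ {i j} → i < j → j < m → orbit i ≢ orbit j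
    distinct {i} {j} i<j j<m eq = minimal (j ∸ i) (≤-<-trans (m∸n≤m j i) j<m)
      (m<n⇒0<n∸m i<j , sym (^[]-injective (step M) (step-injective M) i (≡.trans eq
        (≡.trans (cong (λ k → turn M k z) (sym (m+[n∸m]≡n (<⇒≤ i<j)))) (^[]-+ (step M) i (j ∸ i) z)))))
    reached : ∀ y → y ∈ applyUpTo orbit m
    reached y = let k , eq = single M z y in
      subst (_∈ applyUpTo orbit m) (≡.trans (turn-mod M {m} {z} fixed k) eq) (∈-applyUpTo⁺ orbit (m%n<n k m))

  firstReturn-N : ∀ M z → turn M N z ≡ z × (∀ j → j < N → ¬ (0 < j × turn M j z ≡ z))
  firstReturn-N M z with firstReturn M z
  ... | m , (0<m , fixed) , minimal =
    subst (λ m → turn M m z ≡ z × (∀ j → j < m → ¬ (0 < j × turn M j z ≡ z)))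
      (cycle-length M z m 0<m fixed minimal) (fixed , minimal)

  turn-N : ∀ M z → turn M N z ≡ z
  turn-N M z = proj₁ (firstReturn-N M z)

  turn-minimal : ∀ M z j → j < N → turn M j z ≡ z → j ≡ 0
  turn-minimal M z zero _ _ = refl
  turn-minimal M z (suc j) j<N eq = contradiction (s≤s z≤n , eq) (proj₂ (firstReturn-N M z) (suc j) j<N)

  turn-% : ∀ M k z → turn M (k % N) z ≡ turn M k z
  turn-% M k z = turn-mod M {N} (turn-N M z) k

  turn-fixed⇒∣ : ∀ M z k → turn M k z ≡ z → N ∣ k
  turn-fixed⇒∣ M z k eq = m%n≡0⇒n∣m k N (turn-minimal M z (k % N) (m%n<n k N) (≡.trans (turn-% M k z) eq))

  turn-≤-injective : ∀ M z {a b} → a ≤ b → b < N → turn M a z ≡ turn M b z → a ≡ b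
  turn-≤-injective M z {a} {b} a≤b b<N eq = ≤-antisym a≤b (m∸n≡0⇒m≤n (turn-minimal M z (b ∸ a) (≤-<-trans (m∸n≤m b a) b<N)
    (sym (^[]-injective (step M) (step-injective M) a (≡.trans eq
      (≡.trans (cong (λ k → turn M k z) (sym (m+[n∸m]≡n a≤b))) (^[]-+ (step M) a (b ∸ a) z)))))))

  turn-injective : ∀ M z {a b} → a < N → b < N → turn M a z ≡ turn M b z → a ≡ b
  turn-injective M z {a} {b} a<N b<N eq with ≤-total a b
  ... | inj₁ a≤b = turn-≤-injective M z a≤b b<N eq
  ... | inj₂ b≤a = sym (turn-≤-injective M z b≤a a<N (sym eq))

  abstract
    -- The exponent supplied by `single` is arbitrary; its residue modulo `N` is the unique one
    -- below `N`, so it depends only on the rotation and the two ends.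
    time : Map n → NC n → NC n → ℕ
    time M x y = proj₁ (single M x y) % N

    time<N : ∀ M x y → time M x y < N
    time<N M x y = m%n<n (proj₁ (single M x y)) N

    turn-time : ∀ M x y → turn M (time M x y) x ≡ y
    turn-time M x y = ≡.trans (turn-% M (proj₁ (single M x y)) x) (proj₂ (single M x y))

  letter : Map n → NC n → Letter
  letter M y = time M y (partner y) , kind y

  letter-unique : ∀ M y {δ c} → δ < N → turn M δ y ≡ partner y → kind y ≡ c → letter M y ≡ (δ , c)
  letter-unique M y δ<N eq refl =
    cong (_, kind y) (turn-injective M y (time<N M y (partner y)) δ<N (≡.trans (turn-time M y (partner y)) (sym eq)))

  -- Going to the partner and back is a return to `y`, so `N` divides `ε + δ`. Since `δ > 0` and
  -- both are below `N`, the sum lies strictly between 0 and `2 * N`.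
  letters-mated : ∀ M y → disp (letter M (partner y)) + disp (letter M y) ≡ N
  letters-mated M y = go (turn-fixed⇒∣ M y (ε + δ) (≡.trans (^[]-+ (step M) ε δ y)
    (≡.trans (cong (turn M ε) (turn-time M y (partner y)))
      (≡.trans (turn-time M (partner y) (partner (partner y))) (partner-involutive y)))))
    where
    ε = disp (letter M (partner y))
    δ = disp (letter M y)
    δ≢0 : δ ≢ 0
    δ≢0 δ≡0 = partner≢ y (≡.trans (sym (turn-time M y (partner y))) (cong (λ k → turn M k y) δ≡0))
    go : N ∣ ε + δ → ε + δ ≡ N
    go (divides zero eq) = contradiction (m+n≡0⇒n≡0 ε eq) δ≢0
    go (divides (suc zero) eq) = ≡.trans eq (*-identityˡ N)
    go (divides (suc (suc r)) eq) = contradiction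
      (≤-trans (m≤m+n (N + N) (r * N)) (≤-reflexive (≡.trans (+-assoc N N (r * N)) (sym eq))))
      (<⇒≱ (+-mono-< (time<N M (partner y) (partner (partner y))) (time<N M y (partner y))))

  turn-disp : ∀ M x z → turn M (x + disp (letter M (turn M x z))) z ≡ partner (turn M x z)
  turn-disp M x z = ≡.trans (^[]-+ (step M) x δ z)
    (≡.trans (^[]-comm (step M) x δ z) (turn-time M (turn M x z) (partner (turn M x z))))
    where δ = disp (letter M (turn M x z))

  diagram : Map n → NC n → Diagram n
  diagram M z = record
    { at = λ x → letter M (turn M x z)
    ; periodic = λ x → cong (letter M) (≡.trans (^[]-+ (step M) x N z) (cong (turn M x) (turn-N M z)))
    ; mate-disp = λ x → ≡.trans (cong (λ y → disp (letter M y) + disp (letter M (turn M x z))) (turn-disp M x z))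
        (letters-mated M (turn M x z))
    ; mate-colour = λ x → ≡.trans (cong kind (turn-disp M x z)) (kind-partner (turn M x z))
    }

  diagram-turn : ∀ M a z → shift a (diagram M z) ≈ diagram M (turn M a z)
  diagram-turn M a z x = cong (letter M) (^[]-+ (step M) x a z)

  diagram-base : ∀ M z z′ → diagram M z ⟳ diagram M z′
  diagram-base M z z′ = time M z z′ , λ x → ≡.trans (diagram-turn M (time M z z′) z x)
    (cong (λ z → letter M (turn M x z)) (turn-time M z z′))

  -- Isomorphisms of maps

  -- The conjugation in `actRot` rewritten as equivariance, which needs no inverse of `f`.
  Carries : (Fin n → Fin n) → Map n → Map n → Set
  Carries f M M′ = ∀ y → lift f (step M y) ≡ step M′ (lift f y)

  lift-inverseˡ : ∀ (σ : Permutation′ n) y → lift (σ ⟨$⟩ʳ_) (lift (σ ⟨$⟩ˡ_) y) ≡ y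
  lift-inverseˡ σ y = ≡.trans (lift-∘ (σ ⟨$⟩ʳ_) (σ ⟨$⟩ˡ_) y) (lift-id (λ _ → inverseʳ σ) y)

  lift-inverseʳ : ∀ (σ : Permutation′ n) y → lift (σ ⟨$⟩ˡ_) (lift (σ ⟨$⟩ʳ_) y) ≡ y
  lift-inverseʳ σ y = ≡.trans (lift-∘ (σ ⟨$⟩ˡ_) (σ ⟨$⟩ʳ_) y) (lift-id (λ _ → inverseˡ σ) y)

  actRot⇒carries : ∀ σ M M′ → (∀ x → actRot σ M x ≡ step M′ x) → Carries (σ ⟨$⟩ʳ_) M M′
  actRot⇒carries σ M M′ eq y = ≡.trans (cong (lift (σ ⟨$⟩ʳ_) ∘ step M) (sym (lift-inverseʳ σ y))) (eq (lift (σ ⟨$⟩ʳ_) y))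

  carries⇒actRot : ∀ σ M M′ → Carries (σ ⟨$⟩ʳ_) M M′ → ∀ x → actRot σ M x ≡ step M′ x
  carries⇒actRot σ M M′ carries x = ≡.trans (carries (lift (σ ⟨$⟩ˡ_) x)) (cong (step M′) (lift-inverseˡ σ x))

  carries-turn : ∀ {f} M M′ → Carries f M M′ → ∀ k y → lift f (turn M k y) ≡ turn M′ k (lift f y)
  carries-turn M M′ carries = ^[]-natural (lift _) carries

  carries-letter : ∀ {f} M M′ → Carries f M M′ → ∀ y → letter M′ (lift f y) ≡ letter M y
  carries-letter {f} M M′ carries y = letter-unique M′ (lift f y) (time<N M y (partner y)) (begin
    turn M′ δ (lift f y) ≡⟨ sym (carries-turn M M′ carries δ y) ⟩
    lift f (turn M δ y) ≡⟨ cong (lift f) (turn-time M y (partner y)) ⟩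
    lift f (partner y) ≡⟨ partner-lift f y ⟩
    partner (lift f y) ∎) (kind-lift f y)
    where
    open ≡-Reasoning
    δ = disp (letter M y)

  carries-diagram : ∀ {f} M M′ → Carries f M M′ → ∀ z → diagram M z ≈ diagram M′ (lift f z)
  carries-diagram {f} M M′ carries z x =
    ≡.trans (sym (carries-letter M M′ carries (turn M x z))) (cong (letter M′) (carries-turn M M′ carries x z))

  -- Loops are matched by time of arrival: loop `i` goes to the loop met in `M′` at the moment when
  -- `M` meets the black end of `i`.
  transfer : Map n → NC n → Map n → NC n → Fin n → Fin n
  transfer M z M′ z′ i = loop (turn M′ (time M z (inj₁ i)) z′)

  -- Both rotations have cycle length `N`, so meeting the same end at times `x` and `y` means
  -- congruence modulo `N`, whichever map is considered.
  same-time : ∀ M z M′ z′ {x y} → turn M x z ≡ turn M y z → turn M′ x z′ ≡ turn M′ y z′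
  same-time M z M′ z′ {x} {y} eq = begin
    turn M′ x z′ ≡⟨ sym (turn-% M′ x z′) ⟩
    turn M′ (x % N) z′ ≡⟨ cong (λ k → turn M′ k z′) (turn-injective M z (m%n<n x N) (m%n<n y N)
      (≡.trans (turn-% M x z) (≡.trans eq (sym (turn-% M y z))))) ⟩
    turn M′ (y % N) z′ ≡⟨ turn-% M′ y z′ ⟩
    turn M′ y z′ ∎
    where open ≡-Reasoning

  module _ (M : Map n) (z : NC n) (M′ : Map n) (z′ : NC n) (eq : diagram M z ≈ diagram M′ z′) where

    transfer-black : ∀ x i → turn M x z ≡ inj₁ i → inj₁ (transfer M z M′ z′ i) ≡ turn M′ x z′
    transfer-black x i at-x = begin
      inj₁ (transfer M z M′ z′ i)
        ≡⟨ cong (inj₁ ∘ loop) (same-time M z M′ z′ {time M z (inj₁ i)} {x} (≡.trans (turn-time M z (inj₁ i)) (sym at-x))) ⟩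
      inj₁ (loop (turn M′ x z′))
        ≡⟨ sym (black (turn M′ x z′) (≡.trans (sym (cong colour (eq x))) (cong kind at-x))) ⟩
      turn M′ x z′ ∎
      where open ≡-Reasoning

    -- `transfer` is defined through black ends. A white end is reached from its black partner,
    -- which lies at the same displacement in both maps because the letters agree.
    transfer-turn : ∀ x → lift (transfer M z M′ z′) (turn M x z) ≡ turn M′ x z′
    transfer-turn x with turn M x z in at-x
    ... | inj₁ i = transfer-black x i at-x
    ... | inj₂ i = begin
      partner (inj₁ (transfer M z M′ z′ i))
        ≡⟨ cong partner (transfer-black (x + δ) i (≡.trans (turn-disp M x z) (cong partner at-x))) ⟩
      partner (turn M′ (x + δ) z′)
        ≡⟨ cong (λ a → partner (turn M′ (x + disp a) z′)) (eq x) ⟩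
      partner (turn M′ (x + disp (letter M′ (turn M′ x z′))) z′)
        ≡⟨ cong partner (turn-disp M′ x z′) ⟩
      partner (partner (turn M′ x z′))
        ≡⟨ partner-involutive (turn M′ x z′) ⟩
      turn M′ x z′ ∎
      where
      open ≡-Reasoning
      δ = disp (letter M (turn M x z))

  transfer-inverse : ∀ M z M′ z′ → diagram M z ≈ diagram M′ z′ → ∀ i → transfer M′ z′ M z (transfer M z M′ z′ i) ≡ i
  transfer-inverse M z M′ z′ eq i = inj₁-injective (begin
    lift g (lift f (inj₁ i)) ≡⟨ cong (lift g ∘ lift f) (sym (turn-time M z (inj₁ i))) ⟩
    lift g (lift f (turn M x z)) ≡⟨ cong (lift g) (transfer-turn M z M′ z′ eq x) ⟩
    lift g (turn M′ x z′) ≡⟨ transfer-turn M′ z′ M z (λ x → sym (eq x)) x ⟩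
    turn M x z ≡⟨ turn-time M z (inj₁ i) ⟩
    inj₁ i ∎)
    where
    open ≡-Reasoning
    f = transfer M z M′ z′
    g = transfer M′ z′ M z
    x = time M z (inj₁ i)

  abstract
    relabelling : ∀ M z M′ z′ → diagram M z ≈ diagram M′ z′ →
      ∃[ σ ] (∀ x → lift (σ ⟨$⟩ʳ_) (turn M x z) ≡ turn M′ x z′)
    relabelling M z M′ z′ eq = mk↔ₛ′ (transfer M z M′ z′) (transfer M′ z′ M z)
      (transfer-inverse M′ z′ M z (λ x → sym (eq x))) (transfer-inverse M z M′ z′ eq) , transfer-turn M z M′ z′ eq

  -- Every end is met at some time from `z`, so agreement along this one cycle is equivariance
  -- everywhere.
  turn-relation⇒carries : ∀ {f} M z M′ z′ → (∀ x → lift f (turn M x z) ≡ turn M′ x z′) → Carries f M M′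
  turn-relation⇒carries {f} M z M′ z′ eq y = begin
    lift f (step M y) ≡⟨ cong (lift f ∘ step M) (sym (turn-time M z y)) ⟩
    lift f (turn M (suc x) z) ≡⟨ eq (suc x) ⟩
    step M′ (turn M′ x z′) ≡⟨ cong (step M′) (sym (eq x)) ⟩
    step M′ (lift f (turn M x z)) ≡⟨ cong (step M′ ∘ lift f) (turn-time M z y) ⟩
    step M′ (lift f y) ∎
    where
    open ≡-Reasoning
    x = time M z y

  -- The rotation by `a` is absorbed by moving the base point to `turn M a z`; the words then agree
  -- and give a relabelling.
  ⟳⇒~ : ∀ M z M′ z′ → diagram M z ⟳ diagram M′ z′ → M ~ M′
  ⟳⇒~ M z M′ z′ (a , eq) =
    let σ , rel = relabelling M (turn M a z) M′ z′ (λ x → ≡.trans (sym (diagram-turn M a z x)) (eq x))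
    in σ , carries⇒actRot σ M M′ (turn-relation⇒carries M (turn M a z) M′ z′ rel)

  ~⇒⟳ : ∀ M z M′ z′ → M ~ M′ → diagram M z ⟳ diagram M′ z′
  ~⇒⟳ M z M′ z′ (σ , act) = ⟳-trans {diagram M z} {diagram M′ (lift (σ ⟨$⟩ʳ_) z)} {diagram M′ z′}
    (0 , λ x → ≡.trans (cong (at (diagram M z)) (+-identityʳ x)) (carries-diagram M M′ (actRot⇒carries σ M M′ act) z x))
    (diagram-base M′ (lift (σ ⟨$⟩ʳ_) z) z′)

  -- Automorphisms of maps

  -- An automorphism commutes with the rotation, which is transitive on the ends; so it equals the
  -- power that takes `z` to its image.
  stabilizer⇒turn : ∀ M z σ → InStab σ M →
    ∃[ a ] (a < N × Period a (diagram M z) × ∀ y → lift (σ ⟨$⟩ʳ_) y ≡ turn M a y)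
  stabilizer⇒turn M z σ stab = a , time<N M z σz , period , is-turn
    where
    open ≡-Reasoning
    σz = lift (σ ⟨$⟩ʳ_) z
    a = time M z σz
    carries = actRot⇒carries σ M M stab
    is-turn : ∀ y → lift (σ ⟨$⟩ʳ_) y ≡ turn M a y
    is-turn y = begin
      lift (σ ⟨$⟩ʳ_) y ≡⟨ cong (lift (σ ⟨$⟩ʳ_)) (sym (turn-time M z y)) ⟩
      lift (σ ⟨$⟩ʳ_) (turn M x z) ≡⟨ carries-turn M M carries x z ⟩
      turn M x σz ≡⟨ cong (turn M x) (sym (turn-time M z σz)) ⟩
      turn M x (turn M a z) ≡⟨ ^[]-comm (step M) x a z ⟩
      turn M a (turn M x z) ≡⟨ cong (turn M a) (turn-time M z y) ⟩
      turn M a y ∎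
      where x = time M z y
    period : Period a (diagram M z)
    period x = begin
      letter M (turn M (x + a) z) ≡⟨ diagram-turn M a z x ⟩
      letter M (turn M x (turn M a z)) ≡⟨ cong (letter M ∘ turn M x) (turn-time M z σz) ⟩
      letter M (turn M x σz) ≡⟨ sym (carries-diagram M M carries z x) ⟩
      letter M (turn M x z) ∎

  turn⇒stabilizer : ∀ M a σ → (∀ y → lift (σ ⟨$⟩ʳ_) y ≡ turn M a y) → InStab σ M
  turn⇒stabilizer M a σ is-turn = carries⇒actRot σ M M λ y →
    ≡.trans (is-turn (step M y)) (≡.trans (turn-suc M a y) (cong (step M) (sym (is-turn y))))

  abstract
    -- A period makes the words based at `z` and at `turn M a z` equal, and the relabelling between
    -- them is the turn by `a`.
    period⇒permutation : ∀ M z a → Period a (diagram M z) → ∃[ σ ] (∀ y → lift (σ ⟨$⟩ʳ_) y ≡ turn M a y)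
    period⇒permutation M z a per =
      let σ , rel = relabelling M z M (turn M a z) (λ x → ≡.trans (sym (per x)) (diagram-turn M a z x))
      in σ , λ y → begin
        lift (σ ⟨$⟩ʳ_) y ≡⟨ cong (lift (σ ⟨$⟩ʳ_)) (sym (turn-time M z y)) ⟩
        lift (σ ⟨$⟩ʳ_) (turn M (time M z y) z) ≡⟨ rel (time M z y) ⟩
        turn M (time M z y) (turn M a z) ≡⟨ ^[]-comm (step M) (time M z y) a z ⟩
        turn M a (turn M (time M z y) z) ≡⟨ cong (turn M a) (turn-time M z y) ⟩
        turn M a y ∎
      where open ≡-Reasoning

  -- The generator is the turn by the minimal period `p`. Automorphisms are turns by periods, that
  -- is by multiples of `p`, and there are `N / p` of these modulo `N`.
  symmetry : ∀ M z → DFoldSymmetric (order (diagram M z)) M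
  symmetry M z = τ , cycles , λ σ → stab⇒power σ , power⇒stab σ
    where
    open ≡-Reasoning
    u = diagram M z
    p = minPeriod u
    s = order u
    instance
      p≢0 : NonZero p
      p≢0 = >-nonZero (minPeriod>0 u)
    generator = period⇒permutation M z p (minPeriod-period u)
    τ = proj₁ generator
    power : ∀ j y → lift ((τ ⟨$⟩ʳ_) ^[ j ]) y ≡ turn M (j * p) y
    power j y = begin
      lift ((τ ⟨$⟩ʳ_) ^[ j ]) y ≡⟨ lift-^[] (τ ⟨$⟩ʳ_) j y ⟩
      (lift (τ ⟨$⟩ʳ_) ^[ j ]) y ≡⟨ ^[]-cong (proj₂ generator) j y ⟩
      (turn M p ^[ j ]) y ≡⟨ sym (^[]-* (step M) j p y) ⟩
      turn M (j * p) y ∎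
    cycles : AllCyclesLength s τ
    cycles i = inj₁-injective (≡.trans (power s (inj₁ i))
        (≡.trans (cong (λ k → turn M k (inj₁ i)) (order*minPeriod u)) (turn-N M (inj₁ i)))) ,
      -- An earlier return would make `N = s * p` divide `j * p`, hence `s` divide `j`.
      λ j 0<j j<s eq → >⇒∤ {{>-nonZero 0<j}} j<s (*-cancelʳ-∣ p (subst (_∣ j * p) (sym (order*minPeriod u))
        (turn-fixed⇒∣ M (inj₁ i) (j * p) (≡.trans (sym (power j (inj₁ i))) (cong inj₁ eq)))))
    stab⇒power : ∀ σ → InStab σ M → ∃[ j ] (j < s × (∀ i → σ ⟨$⟩ʳ i ≡ ((τ ⟨$⟩ʳ_) ^[ j ]) i))
    stab⇒power σ stab = j , *-cancelʳ-< p j s (subst (_< s * p) a≡jp (subst (a <_) (sym (order*minPeriod u)) a<N)) ,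
      λ i → inj₁-injective (≡.trans (is-turn (inj₁ i))
        (≡.trans (cong (λ k → turn M k (inj₁ i)) a≡jp) (sym (power j (inj₁ i)))))
      where
      as-turn = stabilizer⇒turn M z σ stab
      a = proj₁ as-turn
      a<N = proj₁ (proj₂ as-turn)
      is-turn = proj₂ (proj₂ (proj₂ as-turn))
      p∣a = minPeriod-∣ u (proj₁ (proj₂ (proj₂ as-turn)))
      j = quotient p∣a
      a≡jp : a ≡ j * p
      a≡jp = m∣n⇒n≡quotient*m p∣a
    power⇒stab : ∀ σ → ∃[ j ] (j < s × (∀ i → σ ⟨$⟩ʳ i ≡ ((τ ⟨$⟩ʳ_) ^[ j ]) i)) → InStab σ M
    power⇒stab σ (j , _ , eq) = turn⇒stabilizer M (j * p) σ λ y → ≡.trans (lift-cong eq y) (power j y)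

  -- `τ` is its own power with exponent 1, except for `d = 1`, where that exponent is out of range
  -- and `τ`, being the identity, has exponent 0.
  generator-stabilizes : ∀ {d} (M : Map n) → 0 < d → (sym-M : DFoldSymmetric d M) → InStab (proj₁ sym-M) M
  generator-stabilizes {suc zero} M _ (τ , cycles , stab) = proj₂ (stab τ) (0 , s≤s z≤n , λ i → proj₁ (cycles i))
  generator-stabilizes {suc (suc d)} M _ (τ , cycles , stab) = proj₂ (stab τ) (1 , s≤s (s≤s z≤n) , λ i → refl)

  -- `τ′` is a power of `τ`, so its `d`-th power is the identity and its cycles cannot be longer
  -- than `d`.
  symmetry-≤ : ∀ {d d′} (M : Map n) → Fin n → 0 < d → 0 < d′ → DFoldSymmetric d M → DFoldSymmetric d′ M → d′ ≤ d
  symmetry-≤ {d} {d′} M i 0<d 0<d′ (τ , cycles , stab) sym′@(τ′ , cycles′ , _) =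
    ≮⇒≥ λ d<d′ → proj₂ (cycles′ i) d 0<d d<d′ (begin
      ((τ′ ⟨$⟩ʳ_) ^[ d ]) i ≡⟨ ^[]-cong is-power d i ⟩
      (((τ ⟨$⟩ʳ_) ^[ j ]) ^[ d ]) i ≡⟨ sym (^[]-* (τ ⟨$⟩ʳ_) d j i) ⟩
      ((τ ⟨$⟩ʳ_) ^[ d * j ]) i ≡⟨ cong (λ k → ((τ ⟨$⟩ʳ_) ^[ k ]) i) (*-comm d j) ⟩
      ((τ ⟨$⟩ʳ_) ^[ j * d ]) i ≡⟨ ^[]-* (τ ⟨$⟩ʳ_) j d i ⟩
      (((τ ⟨$⟩ʳ_) ^[ d ]) ^[ j ]) i ≡⟨ ^[]-fixed ((τ ⟨$⟩ʳ_) ^[ d ]) j i (proj₁ (cycles i)) ⟩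
      i ∎)
    where
    open ≡-Reasoning
    as-power = proj₁ (stab τ′) (generator-stabilizes M 0<d′ sym′)
    j = proj₁ as-power
    is-power = proj₂ (proj₂ as-power)

  symmetry-unique : ∀ {d d′} (M : Map n) → Fin n → 0 < d → 0 < d′ → DFoldSymmetric d M → DFoldSymmetric d′ M → d ≡ d′
  symmetry-unique M i 0<d 0<d′ s s′ = ≤-antisym (symmetry-≤ M i 0<d′ 0<d s′ s) (symmetry-≤ M i 0<d 0<d′ s s′)

-- From diagrams to maps

enumerate : ∀ {k} (xs : List ℕ) → Unique xs → length xs ≡ k →
  Σ[ f ∈ (Fin k → ℕ) ] ((∀ i → f i ∈ xs) × (∀ {i j} → f i ≡ f j → i ≡ j) × (∀ {x} → x ∈ xs → ∃[ i ] f i ≡ x))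
enumerate xs u refl = lookup xs , ∈-lookup , lookup-injective (≡.setoid ℕ) u _ _ ,
  λ x∈ → Any.index x∈ , sym (Anyₚ.lookup-index x∈)

module Realisation (n : ℕ) .{{n≢0 : NonZero n}} (u : Diagram n) where
  open Diagrams n
  open MapDiagrams n
  open ≡-Reasoning

  mate : ℕ → ℕ
  mate x = (x + disp (at u x)) % N

  at-mate : ∀ x → at u (mate x) ≡ at u (x + disp (at u x))
  at-mate x = at-% u (periodic u) (x + disp (at u x))

  mate-involutive : ∀ {x} → x < N → mate (mate x) ≡ x
  mate-involutive {x} x<N = Decoding.mate-sym N 1 x<N refl
    (≡.trans (cong (λ a → disp a + disp (at u x)) (at-mate x)) (≡.trans (mate-disp u x) (sym (*-identityˡ N))))

  mate-injective : ∀ {x y} → x < N → y < N → mate x ≡ mate y → x ≡ y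
  mate-injective x<N y<N eq = ≡.trans (sym (mate-involutive x<N)) (≡.trans (cong mate eq) (mate-involutive y<N))

  colour-mate : ∀ x → colour (at u (mate x)) ≡ not (colour (at u x))
  colour-mate x = ≡.trans (cong colour (at-mate x)) (mate-colour u x)

  mate-% : ∀ x → mate (x % N) ≡ mate x
  mate-% x = ≡.trans (%-absorbˡ x (disp (at u (x % N))) N)
    (cong (λ a → (x + disp a) % N) (at-% u (periodic u) x))

  -- If the mate had displacement 0, then `x` would have displacement `N` and be its own mate,
  -- against the colours.
  disp<N : ∀ x → disp (at u x) < N
  disp<N x = subst (disp (at u x) <_) (mate-disp u x) (m<n+m (disp (at u x)) (n≢0⇒n>0 λ ε≡0 →
    not≢ (≡.trans (sym (cong colour (≡.trans (cong (λ δ → at u (x + δ)) (δ≡N ε≡0)) (periodic u x)))) (mate-colour u x))))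
    where
    δ≡N : disp (at u (x + disp (at u x))) ≡ 0 → disp (at u x) ≡ N
    δ≡N ε≡0 = ≡.trans (cong (_+ disp (at u x)) (sym ε≡0)) (mate-disp u x)

  -- Naming the loops by their black points

  blacks : List ℕ
  blacks = filter (λ x → colour (at u x) Boolₚ.≟ false) (upTo N)

  blacks-unique : Unique blacks
  blacks-unique = Uniqueₚ.filter⁺ _ (Uniqueₚ.upTo⁺ N)

  ∈-blacks⁺ : ∀ {x} → x < N → colour (at u x) ≡ false → x ∈ blacks
  ∈-blacks⁺ x<N = ∈-filter⁺ (λ x → colour (at u x) Boolₚ.≟ false) (∈-upTo⁺ x<N)

  ∈-blacks⁻ : ∀ {x} → x ∈ blacks → x < N × colour (at u x) ≡ false
  ∈-blacks⁻ x∈ = let x∈upTo , eq = ∈-filter⁻ (λ x → colour (at u x) Boolₚ.≟ false) {xs = upTo N} x∈ in ∈-upTo⁻ x∈upTo , eq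

  whites : List ℕ
  whites = filter (¬? ∘ (λ x → colour (at u x) Boolₚ.≟ false)) (upTo N)

  -- `mate` is an involution below `N` that exchanges the colours. Hence half of the `2 * n` points
  -- are black, enough to name the `n` loops.
  length-whites : length whites ≡ length blacks
  length-whites = ≡.trans (↭-length whites↭) (Listₚ.length-map mate blacks)
    where
    mates-unique : ∀ {xs} → All (_< N) xs → Unique xs → Unique (map mate xs)
    mates-unique [] [] = []
    mates-unique {x ∷ xs} (x<N ∷ xs<N) (x# ∷ u) = All.tabulate fresh ∷ mates-unique xs<N u
      where
      fresh : ∀ {y} → y ∈ map mate xs → mate x ≢ y
      fresh y∈ eq with ∈-map⁻ mate y∈
      ... | z , z∈ , refl = All.lookup x# z∈ (mate-injective x<N (All.lookup xs<N z∈) eq)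
    to : ∀ {x} → x ∈ whites → x ∈ map mate blacks
    to {x} x∈ with ∈-filter⁻ (¬? ∘ (λ x → colour (at u x) Boolₚ.≟ false)) {xs = upTo N} x∈
    ... | x∈upTo , white = subst (_∈ map mate blacks) (mate-involutive (∈-upTo⁻ x∈upTo))
      (∈-map⁺ mate (∈-blacks⁺ (m%n<n _ N) (≡.trans (colour-mate x) (cong not (Boolₚ.¬-not white)))))
    from : ∀ {x} → x ∈ map mate blacks → x ∈ whites
    from x∈ with ∈-map⁻ mate x∈
    ... | y , y∈ , refl = ∈-filter⁺ (¬? ∘ (λ x → colour (at u x) Boolₚ.≟ false)) (∈-upTo⁺ (m%n<n _ N))
      λ black → case ≡.trans (sym black) (≡.trans (colour-mate y) (cong not (proj₂ (∈-blacks⁻ y∈)))) of λ ()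
    whites↭ : whites ↭ map mate blacks
    whites↭ = unique∧set⇒↭ (Uniqueₚ.filter⁺ _ (Uniqueₚ.upTo⁺ N))
      (mates-unique (All.tabulate (proj₁ ∘ ∈-blacks⁻)) blacks-unique) to from

  length-blacks : length blacks ≡ n
  length-blacks = *-cancelˡ-≡ _ _ 2 (begin
    2 * length blacks ≡⟨ cong (_+_ (length blacks)) (+-identityʳ (length blacks)) ⟩
    length blacks + length blacks ≡⟨ cong (_+_ (length blacks)) (sym length-whites) ⟩
    length blacks + length whites ≡⟨ length-filter-split (λ x → colour (at u x) Boolₚ.≟ false) (upTo N) ⟩
    length (upTo N) ≡⟨ Listₚ.length-upTo N ⟩
    N ∎)

  blackEnd : Fin n → ℕ
  blackEnd = proj₁ (enumerate blacks blacks-unique length-blacks)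

  blackEnd-black : ∀ i → blackEnd i < N × colour (at u (blackEnd i)) ≡ false
  blackEnd-black i = ∈-blacks⁻ (proj₁ (proj₂ (enumerate blacks blacks-unique length-blacks)) i)

  blackEnd-injective : ∀ {i j} → blackEnd i ≡ blackEnd j → i ≡ j
  blackEnd-injective = proj₁ (proj₂ (proj₂ (enumerate blacks blacks-unique length-blacks)))

  blackEnd-surjective : ∀ {x} → x < N → colour (at u x) ≡ false → ∃[ i ] blackEnd i ≡ x
  blackEnd-surjective x<N eq = proj₂ (proj₂ (proj₂ (enumerate blacks blacks-unique length-blacks))) (∈-blacks⁺ x<N eq)

  -- Putting each white end at the mate of its black end turns `partner` into `mate`.
  place : NC n → ℕ
  place (inj₁ i) = blackEnd i
  place (inj₂ i) = mate (blackEnd i)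

  place<N : ∀ y → place y < N
  place<N (inj₁ i) = proj₁ (blackEnd-black i)
  place<N (inj₂ i) = m%n<n _ N

  kind-place : ∀ y → kind y ≡ colour (at u (place y))
  kind-place (inj₁ i) = sym (proj₂ (blackEnd-black i))
  kind-place (inj₂ i) = sym (≡.trans (colour-mate (blackEnd i)) (cong not (proj₂ (blackEnd-black i))))

  place-partner : ∀ y → place (partner y) ≡ mate (place y)
  place-partner (inj₁ i) = refl
  place-partner (inj₂ i) = sym (mate-involutive (proj₁ (blackEnd-black i)))

  place-injective : ∀ y z → place y ≡ place z → y ≡ z
  place-injective y z eq = go y z eq (≡.trans (kind-place y) (≡.trans (cong (colour ∘ at u) eq) (sym (kind-place z))))
    where
    go : ∀ y z → place y ≡ place z → kind y ≡ kind z → y ≡ z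
    go (inj₁ i) (inj₁ j) eq _ = cong inj₁ (blackEnd-injective eq)
    go (inj₂ i) (inj₂ j) eq _ = cong inj₂ (blackEnd-injective
      (mate-injective (proj₁ (blackEnd-black i)) (proj₁ (blackEnd-black j)) eq))

  place-surjective : ∀ x → x < N → ∃[ y ] place y ≡ x
  place-surjective x x<N with colour (at u x) in col
  ... | false = let i , eq = blackEnd-surjective x<N col in inj₁ i , eq
  ... | true = let i , eq = blackEnd-surjective (m%n<n _ N) (≡.trans (colour-mate x) (cong not col))
               in inj₂ i , ≡.trans (cong mate eq) (mate-involutive x<N)

  label : ℕ → NC n
  label x = proj₁ (place-surjective (x % N) (m%n<n x N))

  place-label : ∀ x → place (label x) ≡ x % N
  place-label x = proj₂ (place-surjective (x % N) (m%n<n x N))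

  label-cong : ∀ {x y} → x % N ≡ y % N → label x ≡ label y
  label-cong {x} {y} eq = place-injective (label x) (label y) (≡.trans (place-label x) (≡.trans eq (sym (place-label y))))

  label-place : ∀ y → label (place y) ≡ y
  label-place y = place-injective (label (place y)) y (≡.trans (place-label (place y)) (m<n⇒m%n≡m (place<N y)))

  label-place+N : ∀ {x} y → x ≡ place y + N → label x ≡ y
  label-place+N y refl = ≡.trans (label-cong ([m+n]%n≡m%n (place y) N)) (label-place y)

  label-suc-place : ∀ x → label (suc (place (label x))) ≡ label (suc x)
  label-suc-place x = label-cong (begin
    suc (place (label x)) % N ≡⟨ cong (λ y → suc y % N) (place-label x) ⟩
    suc (x % N) % N ≡⟨ cong (_% N) (+-comm 1 (x % N)) ⟩
    (x % N + 1) % N ≡⟨ %-absorbˡ x 1 N ⟩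
    (x + 1) % N ≡⟨ cong (_% N) (+-comm x 1) ⟩
    suc x % N ∎)

  -- The successor on the circle of `N` points, transported along `place`; adding `N ∸ 1` is
  -- subtracting 1 modulo `N`.
  next previous : NC n → NC n
  next y = label (suc (place y))
  previous y = label (place y + (N ∸ 1))

  suc-place+N∸1 : ∀ y → suc (place y + (N ∸ 1)) ≡ place y + N
  suc-place+N∸1 y = ≡.trans (sym (+-suc (place y) (N ∸ 1))) (cong (_+_ (place y)) (m+[n∸m]≡n N>0))

  next-previous : ∀ y → next (previous y) ≡ y
  next-previous y = ≡.trans (label-suc-place (place y + (N ∸ 1))) (label-place+N y (suc-place+N∸1 y))

  previous-next : ∀ y → previous (next y) ≡ y
  previous-next y = ≡.trans
    (label-cong (≡.trans (cong (λ z → (z + (N ∸ 1)) % N) (place-label (suc (place y)))) (%-absorbˡ (suc (place y)) (N ∸ 1) N)))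
    (label-place+N y (suc-place+N∸1 y))

  next-label : ∀ k a → (next ^[ k ]) (label a) ≡ label (k + a)
  next-label zero a = refl
  next-label (suc k) a = ≡.trans (cong next (next-label k a)) (label-suc-place (k + a))

  toMap : Map n
  toMap .rot = mk↔ₛ′ next previous next-previous previous-next
  toMap .single x y = k , (begin
    (next ^[ k ]) x ≡⟨ cong (next ^[ k ]) (sym (label-place x)) ⟩
    (next ^[ k ]) (label (place x)) ≡⟨ next-label k (place x) ⟩
    label (k + place x) ≡⟨ label-place+N y (m∸n+n≡m (≤-trans (<⇒≤ (place<N x)) (m≤n+m N (place y)))) ⟩
    y ∎)
    -- The added turn `N` keeps the subtraction from truncating.
    where k = place y + N ∸ place x

  letter-label : ∀ x → letter toMap (label x) ≡ at u x
  letter-label x = letter-unique toMap (label x) (disp<N x) (≡.trans (next-label δ x) (place-injective _ _ (begin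
    place (label (δ + x)) ≡⟨ place-label (δ + x) ⟩
    (δ + x) % N ≡⟨ cong (_% N) (+-comm δ x) ⟩
    mate x ≡⟨ sym (mate-% x) ⟩
    mate (x % N) ≡⟨ cong mate (sym (place-label x)) ⟩
    mate (place (label x)) ≡⟨ sym (place-partner (label x)) ⟩
    place (partner (label x)) ∎)))
    (≡.trans (kind-place (label x)) (cong colour (≡.trans (cong (at u) (place-label x)) (at-% u (periodic u) x))))
    where δ = disp (at u x)

  diagram-toMap : diagram toMap (label 0) ≈ u
  diagram-toMap x = ≡.trans (cong (letter toMap) (next-label x 0)) (≡.trans (letter-label (x + 0)) (cong (at u) (+-identityʳ x)))

-- From rotation classes of diagrams to orbits of maps

theorem14 : (n : ℕ) → 1 ≤ n → (d : ℕ) → d ∣ n →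
    ∃[ rs ] (IsOrbitTransversal {n} (DFoldSymmetric d) rs ×
             (+ (2 * n * length rs) ≡ + d ℤ.* formulaSum n d))
theorem14 n@(suc _) _ d d∣n@(divides q n≡q*d) = map toMap reps , (symmetric , complete , distinct) , (begin
  + (N * length (map toMap reps)) ≡⟨ cong (λ l → + (N * l)) (Listₚ.length-map toMap reps) ⟩
  + (N * length reps) ≡⟨ cong (λ m → + (m * length reps)) (sym dc≡N) ⟩
  + (d * c * length reps) ≡⟨ cong +_ (≡.trans (*-assoc d c (length reps)) (cong (d *_) count)) ⟩
  + (d * length (ofOrder d)) ≡⟨ ℤₚ.pos-* d (length (ofOrder d)) ⟩
  + d ℤ.* + length (ofOrder d) ≡⟨ cong (+ d ℤ.*_) (length-ofOrder d∣n) ⟩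
  + d ℤ.* formulaSum n d ∎)
  where
  open ≡-Reasoning
  open Diagrams n
  open MapDiagrams n
  open Realisation n using (toMap; label; diagram-toMap)
  instance
    d≢0 : NonZero d
    d≢0 = ∣-nonZero d∣n
  -- The minimal period `2 * n / d` of a diagram of order `d`, hence the size of each rotation
  -- class. With `d * c = N` the count needs no division.
  c = 2 * q
  dc≡N : d * c ≡ N
  dc≡N = ≡.trans (*-comm d c) (≡.trans (*-assoc 2 q d) (cong (2 *_) (sym n≡q*d)))
  open Transversal (transversal-ofOrder {d} {c} dc≡N)
  z : NC n
  z = inj₁ zero

  order≡ : ∀ {r} → r ∈ reps → order r ≡ d
  order≡ r∈ = proj₂ (∈-filter⁻ (λ u → order u ≟ d) {xs = allDiagrams} (reps⊆ r∈))

  symmetric : All (DFoldSymmetric d) (map toMap reps)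
  symmetric = All.tabulate λ M∈ → let r , r∈ , M≡ = ∈-map⁻ toMap M∈ in
    subst (DFoldSymmetric d) (sym M≡) (subst (λ d → DFoldSymmetric d (toMap r))
      (≡.trans (order-cong {diagram (toMap r) (label r 0)} {r} (diagram-toMap r)) (order≡ r∈)) (symmetry (toMap r) (label r 0)))

  order>0 : ∀ u → 0 < order u
  order>0 u = >-nonZero⁻¹ (order u) {{∣-nonZero (order-∣ u)}}

  complete : ∀ M → DFoldSymmetric d M → Any (λ R → M ~ R) (map toMap reps)
  complete M sym-M = Anyₚ.map⁺ (Any.map (λ {r} → equivalent r) (covers v∈))
    where
    u = diagram M z
    -- `symmetry` makes `M` also `order u`-fold symmetric, and the degree of symmetry is unique.
    order-u : order u ≡ d
    order-u = symmetry-unique M zero (order>0 u) (>-nonZero⁻¹ d) (symmetry M z) sym-M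
    -- The list contains `u` only up to `≈`; `v` is the listed copy.
    found = find (∈ₛ-filter (λ u → order u ≟ d) (λ {u} {v} u≈v → ≡.trans (sym (order-cong {u} {v} u≈v))) {u} order-u)
    v = proj₁ found
    v∈ = proj₁ (proj₂ found)
    u≈v = proj₂ (proj₂ found)
    equivalent : ∀ r → r ⟳ v → M ~ toMap r
    equivalent r r⟳v = ⟳⇒~ M z (toMap r) (label r 0)
      (⟳-respʳ {u} {r} {diagram (toMap r) (label r 0)} (λ x → sym (diagram-toMap r x))
        (⟳-sym {r} {u} (⟳-respʳ {r} {v} {u} (λ x → sym (u≈v x)) r⟳v)))

  distinct : AllPairs (λ R S → ¬ (R ~ S)) (map toMap reps)
  distinct = AllPairsₚ.map⁺ (AllPairs.map (λ {r} {s} ¬r⟳s R~S → ¬r⟳s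
    (⟳-trans {r} {diagram (toMap r) (label r 0)} {s}
      (0 , λ x → ≡.trans (cong (at r) (+-identityʳ x)) (sym (diagram-toMap r x)))
      (⟳-respʳ {diagram (toMap r) (label r 0)} {diagram (toMap s) (label s 0)} {s} (diagram-toMap s)
        (~⇒⟳ (toMap r) (label r 0) (toMap s) (label s 0) R~S)))) irredundant)
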